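{- Let $q$ be a prime power and let $m+1=(k+1)t$ with integers $k\ge 1$, $t\ge 3$. In the construction described in the context, the computation on any point $A$ of $\mathbb{P}(m,\mathbb{GF}(q))$ is able to reach, and get the data from, all the hyperplanes containing $A$: the data items it fetches from all the subspaces $T\in\mathbb{T}$ together correspond to every hyperplane containing $A$, each exactly once, their total number being the degree $\frac{q^{m}-1}{q-1}$ of the point vertex $A$. Dually, for the computation on any hyperplane $H$, the data items it obtains from all the sets $S\in\mathbb{S}$ together correspond to every point contained in $H$, each exactly once, their total number being the degree $\frac{q^{m}-1}{q-1}$ of the hyperplane vertex.
   Context: $\mathbb{P}(m,\mathbb{GF}(q))$ is the projective space of the $(m+1)$-dimensional $\mathbb{GF}(q)$-vector space $\mathbb{V}=\mathbb{GF}(q^{m+1})$; points are its 1-dimensional and hyperplanes its $m$-dimensional vector subspaces. The computation graph is the bipartite point-hyperplane incidence graph; each edge (incident point-hyperplane pair) is a data item. Let $\alpha$ be a generator of the multiplicative group of $\mathbb{GF}(q^{m+1})$ and $\beta=\frac{q^{m+1}-1}{q^{k+1}-1}$. $\mathbb{S}=\{S_0,\dots,S_{\beta-1}\}$ with $S_i=\{\alpha^{i+j\beta}:0\le j<q^{k+1}-1\}$, the cosets of the multiplicative group of the subfield $\mathbb{GF}(q^{k+1})$; each $S_i\cup\{0\}$ is a $(k+1)$-dimensional $\mathbb{GF}(q)$-subspace, and these partition the points. $\mathbb{T}$ is the set of all distinct $(m-k)$-dimensional vector subspaces (i.e. $(m-k-1)$-dimensional projective subspaces) of $\mathbb{V}$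 obtained as the $\mathbb{GF}(q)$-linear span of the union of $t-1$ sets from $\mathbb{S}$. Construction (data fetching). A point $A$ contained in $S_i$ fetches from each $T\in\mathbb{T}$ the data items corresponding to the hyperplanes that contain both $T$ and $A$: these are $\frac{q^{k+1}-1}{q-1}$ hyperplanes for every $T$ containing $S_i$ (there are $\frac{q^{(k+1)(t-1)}-1}{q^{k+1}-1}$ such $T$), and $\frac{q^{k}-1}{q-1}$ hyperplanes for each of the remaining $T\in\mathbb{T}$. Dually, a hyperplane $H$ obtains from each $S\in\mathbb{S}$ the data items corresponding to the points contained in both $S$ and $H$. -}

module Defs where

open import Level using (Level; suc)
open import Algebra.Apartness.Bundles using (HeytingField; module HeytingCommutativeRing)
open import Algebra.Bundles using (CommutativeRing; Ring; Semiring)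
open import Algebra.Module.Bundles using (LeftModule)
open import Algebra.Morphism.Structures using (IsRingMonomorphism)
import Algebra.Definitions.RawMonoid as RawMonoidDefs
import Algebra.Definitions.RawSemiring as RawSemiringDefs
open import Data.Fin.Base using (Fin; toℕ)
open import Data.Fin.Subset using (Subset; ∣_∣) renaming (_∈_ to _∈ₛ_)
open import Data.Nat.Base as ℕ using (ℕ; NonZero; _∸_; _^_; _/_)
open import Data.Nat.Primality using (Prime; prime⇒nonTrivial)
import Data.Nat.Properties as ℕ
open import Data.Product.Base using (Σ-syntax; ∃-syntax; _×_; _,_)
open import Data.Vec.Functional using (Vector)
open import Function.Bundles using (Inverse)
open import Relation.Binary.Bundles using (Setoid)
open import Relation.Binary.PropositionalEquality as ≡ using (_≡_; refl)
open import Relation.Nullary.Negation using (¬_)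
open import Relation.Unary using (Pred; _∈_; _⊆_; _≐_; _∪_)
open import Relation.Unary.Properties using (≐-refl; ≐-sym; ≐-trans)

private
  variable
    a b ℓ : Level

HasSize : Setoid a b → ℕ → Set _
HasSize S n = Inverse S (≡.setoid (Fin n))

IsPrimePower : ℕ → Set
IsPrimePower q = ∃[ p ] ∃[ e ] Prime p × 1 ℕ.≤ e × q ≡ p ^ e

-- The divisors below are nonzero because q ≥ 2.

private
  2≤p^e : ∀ {n e} → 2 ℕ.≤ n → 1 ℕ.≤ e → 2 ℕ.≤ n ^ e
  2≤p^e {n} {e} 2≤n 1≤e = begin
    2      ≤⟨ 2≤n ⟩
    n      ≡⟨ ℕ.^-identityʳ n ⟨
    n ^ 1  ≤⟨ ℕ.^-monoʳ-≤ n {{ℕ.>-nonZero (ℕ.<⇒≤ 2≤n)}} 1≤e ⟩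
    n ^ e  ∎
    where open ℕ.≤-Reasoning

  2≤q : ∀ {q} → IsPrimePower q → 2 ℕ.≤ q
  2≤q (p , e , p-prime , 1≤e , refl) =
    2≤p^e (ℕ.nonTrivial⇒n>1 p {{prime⇒nonTrivial p-prime}}) 1≤e

  2≤n⇒n∸1-nonZero : ∀ {n} → 2 ℕ.≤ n → NonZero (n ∸ 1)
  2≤n⇒n∸1-nonZero 2≤n = ℕ.>-nonZero (ℕ.m<n⇒0<n∸m 2≤n)

q∸1-nonZero : ∀ {q} → IsPrimePower q → NonZero (q ∸ 1)
q∸1-nonZero pp = 2≤n⇒n∸1-nonZero (2≤q pp)

q^1+n∸1-nonZero : ∀ {q} → IsPrimePower q → ∀ n → NonZero (q ^ ℕ.suc n ∸ 1)
q^1+n∸1-nonZero pp n = 2≤n⇒n∸1-nonZero (2≤p^e {e = ℕ.suc n} (2≤q pp) (ℕ.s≤s ℕ.z≤n))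

-- For finite fields, where ≈ and invertibility are decidable, Heyting fields
-- are the usual fields: x # y is equivalent to ¬ (x ≈ y).

Field : ∀ ℓ → Set (suc ℓ)
Field ℓ = HeytingField ℓ ℓ ℓ

module Field {ℓ} (F : Field ℓ) where
  open HeytingCommutativeRing (HeytingField.heytingCommutativeRing F)
    using (commutativeRing) public
  open CommutativeRing commutativeRing public
  open RawSemiringDefs (Semiring.rawSemiring semiring) public using () renaming (_^_ to _↑_)

module _ {R : Ring ℓ ℓ} (V : LeftModule R ℓ ℓ) where
  private module R = Ring R
  open LeftModule V
  open RawMonoidDefs +ᴹ-rawMonoid using (sum)

  lincomb : ∀ {n} → Vector R.Carrier n → Vector Carrierᴹ n → Carrierᴹ
  lincomb c v = sum (λ i → c i *ₗ v i)

  Span : Pred Carrierᴹ ℓ → Pred Carrierᴹ ℓ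
  Span X x = ∃[ n ] Σ[ c ∈ Vector R.Carrier n ] Σ[ v ∈ Vector Carrierᴹ n ]
    (∀ i → v i ∈ X) × x ≈ᴹ lincomb c v

  LinearlyIndependent : ∀ {n} → Vector Carrierᴹ n → Set ℓ
  LinearlyIndependent v = ∀ c → lincomb c v ≈ᴹ 0ᴹ → ∀ i → c i R.≈ R.0#

  record IsSubspace (W : Pred Carrierᴹ ℓ) : Set ℓ where
    field
      resp      : ∀ {x y} → x ≈ᴹ y → x ∈ W → y ∈ W
      0-closed  : 0ᴹ ∈ W
      +-closed  : ∀ {x y} → x ∈ W → y ∈ W → (x +ᴹ y) ∈ W
      *ₗ-closed : ∀ c {x} → x ∈ W → (c *ₗ x) ∈ W

  record IsBasis (W : Pred Carrierᴹ ℓ) {n} (v : Vector Carrierᴹ n) : Set ℓ where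
    field
      members     : ∀ i → v i ∈ W
      independent : LinearlyIndependent v
      spanning    : ∀ {x} → x ∈ W → ∃[ c ] x ≈ᴹ lincomb c v

  record Subspace (dim : ℕ) : Set (suc ℓ) where
    field
      members    : Pred Carrierᴹ ℓ
      isSubspace : IsSubspace members
      basis      : Vector Carrierᴹ dim
      isBasis    : IsBasis members basis

-- GF(q ^ d) as an extension of GF(q): an embedding of a field with q elements
-- into a field with q ^ d elements.

record Extension ℓ (q d : ℕ) : Set (suc ℓ) where
  field
    K L  : Field ℓ
  module K = Field K
  module L = Field L
  field
    ∣K∣  : HasSize K.setoid q
    ∣L∣  : HasSize L.setoid (q ^ d)
    ι    : K.Carrier → L.Carrier
    mono : IsRingMonomorphism (Ring.rawRing K.ring) (Ring.rawRing L.ring) ι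

  open IsRingMonomorphism mono

  𝕍 : LeftModule K.ring ℓ ℓ
  𝕍 = record
    { Carrierᴹ     = L.Carrier
    ; _≈ᴹ_         = L._≈_
    ; _+ᴹ_         = L._+_
    ; _*ₗ_         = λ c x → ι c L.* x
    ; 0ᴹ           = L.0#
    ; -ᴹ_          = L.-_
    ; isLeftModule = record
      { isLeftSemimodule = record
        { +ᴹ-isCommutativeMonoid = L.+-isCommutativeMonoid
        ; isPreleftSemimodule    = record
          { *ₗ-cong      = λ c≈d x≈y → L.*-cong (⟦⟧-cong c≈d) x≈y
          ; *ₗ-zeroˡ     = λ x → L.trans (L.*-congʳ 0#-homo) (L.zeroˡ x)
          ; *ₗ-distribʳ  = λ x c d → L.trans (L.*-congʳ (+-homo c d)) (L.distribʳ x (ι c) (ι d))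
          ; *ₗ-identityˡ = λ x → L.trans (L.*-congʳ 1#-homo) (L.*-identityˡ x)
          ; *ₗ-assoc     = λ c d x → L.trans (L.*-congʳ (*-homo c d)) (L.*-assoc (ι c) (ι d) x)
          ; *ₗ-zeroʳ     = λ c → L.zeroʳ (ι c)
          ; *ₗ-distribˡ  = λ c x y → L.distribˡ (ι c) x y
          }
        }
      ; -ᴹ‿cong    = L.-‿cong
      ; -ᴹ‿inverse = L.-‿inverse
      }
    }

-- In a finite field natural exponents suffice: inverses are positive powers.

IsGenerator : (F : Field ℓ) → Field.Carrier F → Set ℓ
IsGenerator F α = ¬ (α ≈ 0#) × (∀ x → ¬ (x ≈ 0#) → ∃[ n ] x ≈ α ↑ n)
  where open Field F

module Construction
  {ℓ} {q m : ℕ} (q-pp : IsPrimePower q) (k t : ℕ)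
  (E : Extension ℓ q (ℕ.suc m)) (α : Field.Carrier (Extension.L E))
  where

  open Extension E

  β : ℕ
  β = ((q ^ ℕ.suc m ∸ 1) / (q ^ ℕ.suc k ∸ 1)) {{q^1+n∸1-nonZero q-pp k}}

  Point Hyperplane : Set (suc ℓ)
  Point      = Subspace 𝕍 1
  Hyperplane = Subspace 𝕍 m

  open Subspace using (members)

  infix 4 _⊑_ _≋_

  _⊑_ : ∀ {d e} → Subspace 𝕍 d → Subspace 𝕍 e → Set ℓ
  U ⊑ W = members U ⊆ members W

  -- Subspaces are equal when they have the same vectors, whatever their bases.
  _≋_ : ∀ {d} → Subspace 𝕍 d → Subspace 𝕍 d → Set ℓ
  U ≋ W = members U ≐ members W

  S : Fin β → Pred L.Carrier ℓ
  S i x = ∃[ j ] j ℕ.< q ^ ℕ.suc k ∸ 1 × x L.≈ α L.↑ (toℕ i ℕ.+ j ℕ.* β)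

  -- S i consists of nonzero vectors, whereas a point, as a subspace, has 0.
  S∪0 : Fin β → Pred L.Carrier ℓ
  S∪0 i = S i ∪ (L._≈ L.0#)

  ⋃S : Subset β → Pred L.Carrier ℓ
  ⋃S I x = ∃[ i ] i ∈ₛ I × x ∈ S i

  record 𝕋 : Set (suc ℓ) where
    field
      space   : Subspace 𝕍 (m ∸ k)
      indices : Subset β
      size    : ∣ indices ∣ ≡ t ∸ 1
      spanned : members space ≐ Span 𝕍 (⋃S indices)

  open 𝕋 using (space)

  -- The edges at the vertex A (the data items at A) and at the vertex H; an
  -- edge at a given vertex is determined by its other end.

  EdgesAtPoint : Point → Setoid (suc ℓ) ℓ
  EdgesAtPoint A = record
    { Carrier       = Σ[ H ∈ Hyperplane ] A ⊑ H
    ; _≈_           = λ (H , _) (H′ , _) → H ≋ H′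
    ; isEquivalence = record { refl = ≐-refl ; sym = ≐-sym ; trans = ≐-trans }
    }

  EdgesAtHyperplane : Hyperplane → Setoid (suc ℓ) ℓ
  EdgesAtHyperplane H = record
    { Carrier       = Σ[ A ∈ Point ] A ⊑ H
    ; _≈_           = λ (A , _) (A′ , _) → A ≋ A′
    ; isEquivalence = record { refl = ≐-refl ; sym = ≐-sym ; trans = ≐-trans }
    }

  -- The fetches made by A: one for each T in 𝕋 and each data item taken from
  -- T. Members of 𝕋 are compared as subspaces, so a T that is spanned by
  -- several unions occurs only once.

  FetchesByPoint : Point → Setoid (suc ℓ) ℓ
  FetchesByPoint A = record
    { Carrier       = Σ[ T ∈ 𝕋 ] Σ[ (H , _) ∈ Setoid.Carrier (EdgesAtPoint A) ] space T ⊑ H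
    ; _≈_           = λ (T , (H , _) , _) (T′ , (H′ , _) , _) → space T ≋ space T′ × H ≋ H′
    ; isEquivalence = record
      { refl  = ≐-refl , ≐-refl
      ; sym   = λ (p , r) → ≐-sym p , ≐-sym r
      ; trans = λ (p , r) (p′ , r′) → ≐-trans p p′ , ≐-trans r r′
      }
    }

  FetchesByHyperplane : Hyperplane → Setoid (suc ℓ) ℓ
  FetchesByHyperplane H = record
    { Carrier       = Σ[ i ∈ Fin β ] Σ[ (A , _) ∈ Setoid.Carrier (EdgesAtHyperplane H) ] members A ⊆ S∪0 i
    ; _≈_           = λ (i , (A , _) , _) (i′ , (A′ , _) , _) → i ≡ i′ × A ≋ A′
    ; isEquivalence = record
      { refl  = refl , ≐-refl
      ; sym   = λ (p , r) → ≡.sym p , ≐-sym r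
      ; trans = λ (p , r) (p′ , r′) → ≡.trans p p′ , ≐-trans r r′
      }
    }

  itemByPoint : ∀ A → Setoid.Carrier (FetchesByPoint A) → Setoid.Carrier (EdgesAtPoint A)
  itemByPoint A (_ , e , _) = e

  itemByHyperplane : ∀ H → Setoid.Carrier (FetchesByHyperplane H) → Setoid.Carrier (EdgesAtHyperplane H)
  itemByHyperplane H (_ , e , _) = e

{-# OPTIONS --safe #-}
-- Counting is done with coordinates: the points of a d-dimensional subspace
-- and the hyperplanes through a point (kernels of linear forms vanishing
-- there) are enumerated by normalised coordinate vectors. The S i are the cosets
-- of the multiplicative group of the subfield
-- F = GF(q^(k+1)), so every point lies in exactly one of them. A hyperplane H
-- contains a largest F-subspace {x : F x ⊆ H}, the common kernel of k + 1 linear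
-- forms; since its size is a power of q^(k+1), its dimension over F is exactly t - 1,
-- and it is the only T in 𝕋 contained in H.

module Submission where

open import Defs
open import Level using (Level; _⊔_)
open import Algebra.Apartness.Bundles using (HeytingField)
open import Algebra.Bundles using (CommutativeMonoid; CommutativeRing; Group)
open import Algebra.Module.Bundles using (LeftModule)
import Algebra.Module.Construct.TensorUnit as TensorUnit
open import Algebra.Morphism.Structures using (IsRingMonomorphism)
import Algebra.Properties.CommutativeMonoid.Sum as Sum
import Algebra.Properties.CommutativeSemiring.Binomial as Binomial
import Algebra.Properties.CommutativeSemiring.Exp as Exp
import Algebra.Properties.Group as GroupProperties
import Algebra.Properties.Ring as RingProperties
import Algebra.Properties.Semiring.Mult as Mult
open import Data.Fin.Base as Fin using (Fin; zero; suc; toℕ)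
open import Data.Fin.Permutation using (permutation)
import Data.Fin.Properties as Fin
open import Data.Fin.Subset using (Subset; ∣_∣; _∪_; ⁅_⁆; inside; outside)
  renaming (_∈_ to _∈ₛ_; _∉_ to _∉ₛ_; ⊥ to ∅)
import Data.Fin.Subset.Properties as Subset
open import Data.Nat.Base using (ℕ; zero; suc; _≤_; _<_; _+_; _*_; _^_; _∸_; _/_; _%_; _!; s≤s; z≤n; s≤s⁻¹;
  NonZero; >-nonZero; >-nonZero⁻¹; ≢-nonZero⁻¹; nonTrivial⇒n>1)
open import Data.Nat.Combinatorics using (_C_; nCn≡1; nCk≡n!/k![n-k]!; k![n∸k]!∣n!)
open import Data.Nat.Divisibility using (_∣_; ∣⇒≤; divides; m∣m*n)
open import Data.Nat.DivMod using (m*n/n≡m; m/n*n≡m; m≡m%n+[m/n]*n; m%n<n; [m+kn]%n≡m%n; m<n⇒m%n≡m)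
open import Data.Nat.Primality using (Prime; euclidsLemma; prime⇒nonTrivial; prime⇒nonZero)
import Data.Nat.Properties as ℕ
open import Data.Product.Base using (Σ-syntax; ∃; ∃-syntax; _×_; _,_; proj₁; proj₂)
open import Data.Sum.Base using (_⊎_; inj₁; inj₂)
open import Data.Sum.Function.Propositional using (_⊎-↔_)
open import Data.Unit.Polymorphic.Base using (⊤; tt)
import Data.Vec.Base as Vec
open import Data.Vec.Functional as Vector using (Vector; _∷_; [])
import Data.Vec.Functional.Properties as Vector
import Data.Vec.Functional.Relation.Binary.Equality.Setoid as VecEq
open import Function.Base using (_∘_; id)
open import Function.Bundles using (Inverse; _↔_)
open import Function.Construct.Composition using (_↔-∘_)
open import Function.Construct.Identity using (↔-id)
open import Function.Definitions using (Bijective)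
open import Relation.Binary.Bundles using (Setoid)
import Relation.Binary.Construct.On as On
open import Relation.Binary.Definitions as B using (_Respects_; tri<; tri≈; tri>)
open import Relation.Binary.PropositionalEquality as ≡ using (_≡_; _≢_; refl)
import Relation.Binary.Reasoning.Setoid as ≈-Reasoning
open import Relation.Nullary using (¬_; Dec; yes; no)
open import Relation.Nullary.Decidable using (map′; _×-dec_; _→-dec_; ¬?; decidable-stable)
open import Relation.Nullary.Negation using (contradiction)
open import Relation.Unary using (Pred; Decidable; _∈_; _∉_; _⊆_; _≐_)
open import Relation.Unary.Properties using (≐-refl; ≐-sym; ≐-trans)

-- The core has dimension exactly t - 1 for this reason: its codimension over GF(q) is at least 1,
-- as it lies in H, and at most k + 1, as the common kernel of k + 1 forms; being an F-subspace of
-- an F-space, it has codimension divisible by k + 1, hence equal to k + 1. Dimensions are compared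
-- through the sizes q^d of finite sets, by pigeonhole. A T in `𝕋` inside H is the core: T is closed
-- under multiplication by F because each S i is, up to 0, so T lies in the core, and both have
-- dimension m - k. The core belongs to `𝕋` because an F-basis of it meets t - 1 distinct cosets.
-- The subfield must be produced inside L: it is the solution set of x^Q = x with Q = q^(k+1), and
-- its closure under addition is the Frobenius identity in characteristic p. Linear algebra is
-- needed over both GF(q) and F, so it is developed once for commutative rings with inverses of
-- nonzero elements, which spares F an apartness relation. Finiteness makes the membership tests
-- decidable by search.

private
  variable
    a b ℓ p : Level

-- Powers and repunits.

n<m^n : ∀ m n → 2 ≤ m → n < m ^ n
n<m^n m zero    _   = s≤s z≤n
n<m^n m (suc n) 2≤m = begin-strict
  suc n         <⟨ s≤s (n<m^n m n 2≤m) ⟩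
  suc (m ^ n)   ≤⟨ ℕ.+-monoˡ-≤ (m ^ n) (ℕ.m^n>0 m n) ⟩
  m ^ n + m ^ n ≡⟨ ≡.cong (m ^ n +_) (ℕ.+-identityʳ (m ^ n)) ⟨
  2 * m ^ n     ≤⟨ ℕ.*-monoˡ-≤ (m ^ n) 2≤m ⟩
  m * m ^ n     ∎
  where
  open ℕ.≤-Reasoning
  instance _ = >-nonZero (ℕ.<⇒≤ 2≤m)

^-cancelʳ-≤ : ∀ m {n o} → 2 ≤ m → m ^ n ≤ m ^ o → n ≤ o
^-cancelʳ-≤ m 2≤m m^n≤m^o = ℕ.≮⇒≥ λ o<n → ℕ.<⇒≱ (ℕ.^-monoʳ-< m 2≤m o<n) m^n≤m^o

^-cancelʳ-≡ : ∀ m {n o} → 2 ≤ m → m ^ n ≡ m ^ o → n ≡ o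
^-cancelʳ-≡ m 2≤m eq =
  ℕ.≤-antisym (^-cancelʳ-≤ m 2≤m (ℕ.≤-reflexive eq)) (^-cancelʳ-≤ m 2≤m (ℕ.≤-reflexive (≡.sym eq)))

-- The number of points of the projective space of an n-dimensional space over GF(q). Written as a
-- sum, it follows the listing of points by the position of the leading coordinate; to base q^(k+1)
-- it also evaluates `β`.
repunit : ℕ → ℕ → ℕ
repunit q zero    = 0
repunit q (suc n) = q ^ n + repunit q n

repunit-*-∸1 : ∀ q n → 1 ≤ q → repunit q n * (q ∸ 1) ≡ q ^ n ∸ 1
repunit-*-∸1 (suc q) n _ = ≡.trans (≡.sym (ℕ.m+n∸m≡n 1 (repunit (suc q) n * q))) (≡.cong (_∸ 1) (go n))
  where
  -- The 1 is moved to the other side, so that the induction is free of truncated subtraction.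
  go : ∀ n → suc (repunit (suc q) n * q) ≡ suc q ^ n
  go zero    = refl
  go (suc n) = begin
    suc ((Q + repunit (suc q) n) * q)     ≡⟨ ≡.cong suc (ℕ.*-distribʳ-+ q Q (repunit (suc q) n)) ⟩
    suc (Q * q + repunit (suc q) n * q)   ≡⟨ ℕ.+-suc (Q * q) _ ⟨
    Q * q + suc (repunit (suc q) n * q)   ≡⟨ ≡.cong (Q * q +_) (go n) ⟩
    Q * q + Q                             ≡⟨ ℕ.+-comm (Q * q) Q ⟩
    Q + Q * q                             ≡⟨ ≡.cong (Q +_) (ℕ.*-comm Q q) ⟩
    suc q * Q                             ∎
    where
    open ≡.≡-Reasoning
    Q = suc q ^ n

repunit-/ : ∀ q n → 1 ≤ q → .{{_ : NonZero (q ∸ 1)}} → repunit q n ≡ (q ^ n ∸ 1) / (q ∸ 1)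
repunit-/ q n 1≤q = ≡.trans (≡.sym (m*n/n≡m (repunit q n) (q ∸ 1))) (≡.cong (_/ (q ∸ 1)) (repunit-*-∸1 q n 1≤q))

-- Finite setoids and counting.

enumeration⇒HasSize : ∀ {n} {I : Set} {S : Setoid a b} (let open Setoid S) → Fin n ↔ I →
  (f : I → Carrier) → (∀ {i j} → f i ≈ f j → i ≡ j) → (∀ x → ∃[ i ] x ≈ f i) → HasSize S n
enumeration⇒HasSize {S = S} I↔ f f-inj f-surj = record
  { to        = λ x → I.from (proj₁ (f-surj x))
  ; from      = λ i → f (I.to i)
  -- Equal elements could be given different preimages by `f-surj`; injectivity of `f` identifies
  -- them.
  ; to-cong   = λ {x} {y} x≈y → ≡.cong I.from
      (f-inj (trans (sym (proj₂ (f-surj x))) (trans x≈y (proj₂ (f-surj y)))))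
  ; from-cong = λ { refl → Setoid.refl S }
  ; inverse   =
      (λ {i} {y} y≈fi → ≡.trans
        (≡.cong I.from (f-inj (trans (sym (proj₂ (f-surj y))) y≈fi)))
        (I.strictlyInverseʳ i))
    , (λ {x} → λ { refl → trans
        (reflexive (≡.cong f (I.strictlyInverseˡ (proj₁ (f-surj x)))))
        (sym (proj₂ (f-surj x))) })
  }
  where
  open Setoid S hiding (refl)
  module I = Inverse I↔

-- A size makes equality decidable and turns quantifiers over the setoid into searches over `Fin`;
-- this takes the place of excluded middle in the linear algebra.
module Finite {S : Setoid a b} {n} (∣S∣ : HasSize S n) where
  open Setoid S hiding (refl)
  open Inverse ∣S∣ using (strictlyInverseʳ; strictlyInverseˡ; to-cong) renaming (to to index; from to element) public

  index-injective : ∀ {x y} → index x ≡ index y → x ≈ y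
  index-injective {x} {y} eq =
    trans (sym (strictlyInverseʳ x)) (trans (reflexive (≡.cong element eq)) (strictlyInverseʳ y))

  element-injective : ∀ {i j} → element i ≈ element j → i ≡ j
  element-injective {i} {j} eq =
    ≡.trans (≡.sym (strictlyInverseˡ i)) (≡.trans (to-cong eq) (strictlyInverseˡ j))

  _≟_ : B.Decidable _≈_
  x ≟ y = map′ index-injective to-cong (index x Fin.≟ index y)

  module _ {P : Pred Carrier p} (resp : P Respects _≈_) (P? : Decidable P) where

    any? : Dec (∃ P)
    any? = map′ (λ (i , Pi) → element i , Pi)
                (λ (x , Px) → index x , resp (sym (strictlyInverseʳ x)) Px)
                (Fin.any? (λ i → P? (element i)))

    all? : Dec (∀ x → P x)
    all? = map′ (λ ∀P x → resp (strictlyInverseʳ x) (∀P (index x)))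
                (λ ∀P i → ∀P (element i))
                (Fin.all? (λ i → P? (element i)))

    ¬∀⇒∃¬ : ¬ (∀ x → P x) → ∃[ x ] ¬ P x
    ¬∀⇒∃¬ ¬∀ with Fin.¬∀⟶∃¬ n _ (λ i → P? (element i)) (λ ∀P → ¬∀ λ x → resp (strictlyInverseʳ x) (∀P (index x)))
    ... | i , ¬Pi = element i , ¬Pi

-- Pigeonhole on the canonical elements `S.element i`. The map may be a mere choice that does not
-- respect equality, such as an exponent chosen for each power of a generator.
injection⇒≤ : ∀ {a′ b′ m n} {S : Setoid a b} {T : Setoid a′ b′} →
  HasSize S m → HasSize T n → (let module S = Setoid S; module T = Setoid T) →
  (f : S.Carrier → T.Carrier) → (∀ {x y} → f x T.≈ f y → x S.≈ y) → m ≤ n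
injection⇒≤ {S = S} {T = T} ∣S∣ ∣T∣ f f-inj =
  Fin.injective⇒≤ {f = λ i → T.index (f (S.element i))}
    (λ eq → S.element-injective (f-inj (T.index-injective eq)))
  where
  module S = Finite ∣S∣
  module T = Finite ∣T∣

≡-size : ∀ n → HasSize (≡.setoid (Fin n)) n
≡-size n = enumeration⇒HasSize (↔-id (Fin n)) id id (λ i → i , refl)

-- Membership proofs are not compared, so a size of this setoid counts the elements of the subset.
∃-setoid : ∀ (S : Setoid a b) → Pred (Setoid.Carrier S) p → Setoid (a ⊔ p) b
∃-setoid S P = On.setoid {B = ∃ P} S proj₁

funToFin-cong : ∀ {m n} {f g : Fin m → Fin n} → (∀ i → f i ≡ g i) → Fin.funToFin f ≡ Fin.funToFin g
funToFin-cong {zero}  f≗g = refl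
funToFin-cong {suc m} f≗g = ≡.cong₂ Fin.combine (f≗g zero) (funToFin-cong (f≗g ∘ suc))

vectors-size : ∀ {S : Setoid a b} {q} → HasSize S q → ∀ n → HasSize (VecEq.≋-setoid S n) (q ^ n)
vectors-size {S = S} {q} ∣S∣ n = enumeration⇒HasSize (↔-id (Fin (q ^ n)))
  (λ i k → F.element (Fin.finToFun i k))
  (λ {i} {j} eq → ≡.trans (≡.sym (Fin.funToFin-finToFin {n} {q} i))
      (≡.trans (funToFin-cong (λ k → F.element-injective (eq k))) (Fin.funToFin-finToFin {n} {q} j)))
  (λ c → Fin.funToFin (F.index ∘ c) , λ k → Setoid.trans S (Setoid.sym S (F.strictlyInverseʳ (c k)))
      (Setoid.reflexive S (≡.cong F.element (≡.sym (Fin.finToFun-funToFin (F.index ∘ c) k)))))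
  where module F = Finite ∣S∣

bijective⇒HasSize : ∀ {a′ b′ n} {S : Setoid a b} {T : Setoid a′ b′} (let module S = Setoid S; module T = Setoid T) →
  (f : S.Carrier → T.Carrier) → Bijective S._≈_ T._≈_ f → HasSize T n → HasSize S n
bijective⇒HasSize {S = S} {T = T} f (f-inj , f-surj) ∣T∣ = enumeration⇒HasSize (↔-id _)
  (λ i → proj₁ (f-surj (F.element i)))
  (λ {i} {j} eq → F.element-injective
    (T.trans (T.sym (proj₂ (f-surj (F.element i)) (S.sym eq))) (proj₂ (f-surj (F.element j)) S.refl)))
  (λ x → F.index (f x) , f-inj (T.sym (T.trans (proj₂ (f-surj _) S.refl) (F.strictlyInverseʳ (f x)))))
  where
  module S = Setoid S
  module T = Setoid T
  module F = Finite ∣T∣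

-- Linear combinations and linear forms.

HasInverses : CommutativeRing ℓ ℓ → Set ℓ
HasInverses R = ∀ x → ¬ x ≈ 0# → ∃[ y ] y ⊛ x ≈ 1#
  where open CommutativeRing R using (_≈_; 0#; 1#) renaming (_*_ to _⊛_)

module Inverses {ℓ} (R : CommutativeRing ℓ ℓ) (inverses : HasInverses R) where
  private module R = CommutativeRing R

  invert : ∀ {x} → ¬ x R.≈ R.0# → ∃[ y ] y R.* x R.≈ R.1#
  invert = inverses _

  *-cancelˡ-0 : ∀ {s x} → s R.* x R.≈ R.0# → ¬ s R.≈ R.0# → x R.≈ R.0#
  *-cancelˡ-0 {s} {x} sx≈0 s≉0 with invert s≉0
  ... | s⁻¹ , s⁻¹s≈1 = begin
    x                   ≈⟨ R.*-identityˡ x ⟨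
    R.1# R.* x          ≈⟨ R.*-congʳ s⁻¹s≈1 ⟨
    (s⁻¹ R.* s) R.* x   ≈⟨ R.*-assoc s⁻¹ s x ⟩
    s⁻¹ R.* (s R.* x)   ≈⟨ R.*-congˡ sx≈0 ⟩
    s⁻¹ R.* R.0#        ≈⟨ R.zeroʳ s⁻¹ ⟩
    R.0#                ∎
    where open ≈-Reasoning R.setoid

module LinearCombinations {ℓ} (R : CommutativeRing ℓ ℓ) (V : LeftModule (CommutativeRing.ring R) ℓ ℓ) where
  private module R = CommutativeRing R
  open LeftModule V
  open Sum +ᴹ-commutativeMonoid using (sum-cong-≋; ∑-distrib-+; sum-replicate-zero)
  open GroupProperties +ᴹ-group using (∙-cancelʳ; inverseˡ-unique; inverseʳ-unique)
  open ≈-Reasoning ≈ᴹ-setoid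

  private
    variable
      n : ℕ
      x y : Carrierᴹ

  infixl 6 _-ᴹ_
  _-ᴹ_ : Carrierᴹ → Carrierᴹ → Carrierᴹ
  x -ᴹ y = x +ᴹ -ᴹ y

  x-y+y≈x : ∀ x y → x -ᴹ y +ᴹ y ≈ᴹ x
  x-y+y≈x x y = begin
    x +ᴹ -ᴹ y +ᴹ y   ≈⟨ +ᴹ-assoc x (-ᴹ y) y ⟩
    x +ᴹ (-ᴹ y +ᴹ y) ≈⟨ +ᴹ-congˡ (-ᴹ‿inverseˡ y) ⟩
    x +ᴹ 0ᴹ          ≈⟨ +ᴹ-identityʳ x ⟩
    x                ∎

  -1*x≈-x : ∀ x → (R.- R.1#) *ₗ x ≈ᴹ -ᴹ x
  -1*x≈-x x = inverseˡ-unique _ x (begin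
    (R.- R.1#) *ₗ x +ᴹ x          ≈⟨ +ᴹ-congˡ (*ₗ-identityˡ x) ⟨
    (R.- R.1#) *ₗ x +ᴹ R.1# *ₗ x  ≈⟨ *ₗ-distribʳ x (R.- R.1#) R.1# ⟨
    (R.- R.1# R.+ R.1#) *ₗ x      ≈⟨ *ₗ-congʳ (R.-‿inverseˡ R.1#) ⟩
    R.0# *ₗ x                     ≈⟨ *ₗ-zeroˡ x ⟩
    0ᴹ                            ∎)

  lincomb-cong : ∀ {c d : Vector R.Carrier n} {v w} → (∀ i → c i R.≈ d i) → (∀ i → v i ≈ᴹ w i) → lincomb V c v ≈ᴹ lincomb V d w
  lincomb-cong c≈d v≈w = sum-cong-≋ (λ i → *ₗ-cong (c≈d i) (v≈w i))

  lincomb-congˡ : ∀ {c d : Vector R.Carrier n} {v} → (∀ i → c i R.≈ d i) → lincomb V c v ≈ᴹ lincomb V d v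
  lincomb-congˡ c≈d = lincomb-cong c≈d (λ _ → ≈ᴹ-refl)

  lincomb-+ : ∀ (c d : Vector R.Carrier n) v → lincomb V (λ i → c i R.+ d i) v ≈ᴹ lincomb V c v +ᴹ lincomb V d v
  lincomb-+ c d v = ≈ᴹ-trans (sum-cong-≋ (λ i → *ₗ-distribʳ (v i) (c i) (d i))) (∑-distrib-+ (λ i → c i *ₗ v i) (λ i → d i *ₗ v i))

  lincomb-* : ∀ s (c : Vector R.Carrier n) v → lincomb V (λ i → s R.* c i) v ≈ᴹ s *ₗ lincomb V c v
  lincomb-* {zero}  s c v = ≈ᴹ-sym (*ₗ-zeroʳ s)
  lincomb-* {suc n} s c v = ≈ᴹ-trans
    (+ᴹ-cong (*ₗ-assoc s _ _) (lincomb-* s (c ∘ suc) (v ∘ suc)))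
    (≈ᴹ-sym (*ₗ-distribˡ s _ _))

  lincomb-zero : ∀ {c : Vector R.Carrier n} {v} → (∀ i → c i R.≈ R.0#) → lincomb V c v ≈ᴹ 0ᴹ
  lincomb-zero {n = n} {v = v} c≈0 = ≈ᴹ-trans
    (sum-cong-≋ (λ i → ≈ᴹ-trans (*ₗ-congʳ (c≈0 i)) (*ₗ-zeroˡ (v i))))
    (sum-replicate-zero n)

  lincomb-zeroʳ : ∀ (c : Vector R.Carrier n) {v} → (∀ i → v i ≈ᴹ 0ᴹ) → lincomb V c v ≈ᴹ 0ᴹ
  lincomb-zeroʳ {n = n} c v≈0 = ≈ᴹ-trans
    (sum-cong-≋ (λ i → ≈ᴹ-trans (*ₗ-congˡ (v≈0 i)) (*ₗ-zeroʳ (c i))))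
    (sum-replicate-zero n)

  lincomb-*ʳ : ∀ s (c : Vector R.Carrier n) v → lincomb V c (λ i → s *ₗ v i) ≈ᴹ s *ₗ lincomb V c v
  lincomb-*ʳ s c v = ≈ᴹ-trans
    (sum-cong-≋ (λ i → ≈ᴹ-trans (≈ᴹ-sym (*ₗ-assoc (c i) s (v i))) (*ₗ-congʳ (R.*-comm (c i) s))))
    (lincomb-* s c v)

  lincomb-closed : ∀ {W} → IsSubspace V W → ∀ {v} (c : Vector R.Carrier n) → (∀ i → v i ∈ W) → lincomb V c v ∈ W
  lincomb-closed {zero}  W c v∈W = IsSubspace.0-closed W
  lincomb-closed {suc n} W c v∈W =
    IsSubspace.+-closed W (IsSubspace.*ₗ-closed W (c zero) (v∈W zero)) (lincomb-closed W (c ∘ suc) (v∈W ∘ suc))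

  unit : Fin n → Vector R.Carrier n
  unit i = Vector.updateAt (λ _ → R.0#) i (λ _ → R.1#)

  lincomb-unit : ∀ i (v : Vector Carrierᴹ n) → lincomb V (unit i) v ≈ᴹ v i
  lincomb-unit zero    v = begin
    R.1# *ₗ v zero +ᴹ lincomb V (λ _ → R.0#) (v ∘ suc) ≈⟨ +ᴹ-cong (*ₗ-identityˡ _) (lincomb-zero {v = v ∘ suc} (λ _ → R.refl)) ⟩
    v zero +ᴹ 0ᴹ ≈⟨ +ᴹ-identityʳ _ ⟩
    v zero ∎
  lincomb-unit (suc i) v = begin
    R.0# *ₗ v zero +ᴹ lincomb V (unit i) (v ∘ suc) ≈⟨ +ᴹ-cong (*ₗ-zeroˡ _) (lincomb-unit i (v ∘ suc)) ⟩
    0ᴹ +ᴹ v (suc i) ≈⟨ +ᴹ-identityˡ _ ⟩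
    v (suc i) ∎

  unit-diagonal : ∀ (i : Fin n) → unit i i R.≈ R.1#
  unit-diagonal i = R.reflexive (Vector.updateAt-updates i _)

  unit-offDiagonal : ∀ {i j : Fin n} → i ≢ j → unit i j R.≈ R.0#
  unit-offDiagonal {i = i} {j} i≢j = R.reflexive (Vector.updateAt-minimal j i _ (i≢j ∘ ≡.sym))

  -- One coefficient for each vector of a fixed family, so over a finite ring it can be decided by
  -- search; the combinations in `Span` have unbounded length.
  InSpan : Vector Carrierᴹ n → Pred Carrierᴹ ℓ
  InSpan v x = ∃[ c ] x ≈ᴹ lincomb V c v

  span-isSubspace : (v : Vector Carrierᴹ n) → IsSubspace V (InSpan v)
  span-isSubspace v = record
    { resp      = λ x≈y (c , x≈cv) → c , ≈ᴹ-trans (≈ᴹ-sym x≈y) x≈cv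
    ; 0-closed  = (λ _ → R.0#) , ≈ᴹ-sym (lincomb-zero {v = v} (λ _ → R.refl))
    ; +-closed  = λ (c , x≈) (d , y≈) → _ , ≈ᴹ-trans (+ᴹ-cong x≈ y≈) (≈ᴹ-sym (lincomb-+ c d v))
    ; *ₗ-closed = λ s (c , x≈) → _ , ≈ᴹ-trans (*ₗ-congˡ x≈) (≈ᴹ-sym (lincomb-* s c v))
    }

  independent⇒injective : ∀ {v : Vector Carrierᴹ n} {c d} → LinearlyIndependent V v → lincomb V c v ≈ᴹ lincomb V d v → ∀ i → c i R.≈ d i
  independent⇒injective {v = v} {c = c} {d = d} indep eq i =
    G.∙-cancelʳ (R.- d i) (c i) (d i) (R.trans (indep c-d c-d≈0 i) (R.sym (R.-‿inverseʳ (d i))))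
    where
    module G = GroupProperties R.+-group
    c-d : Vector _ _
    c-d i = c i R.- d i
    c-d≈0 : lincomb V c-d v ≈ᴹ 0ᴹ
    c-d≈0 = ∙-cancelʳ (lincomb V d v) _ _ (begin
      lincomb V c-d v +ᴹ lincomb V d v   ≈⟨ lincomb-+ c-d d v ⟨
      lincomb V (λ i → c-d i R.+ d i) v  ≈⟨ lincomb-congˡ {v = v} (λ i → R.trans (R.+-assoc _ _ _) (R.trans (R.+-congˡ (R.-‿inverseˡ (d i))) (R.+-identityʳ _))) ⟩
      lincomb V c v                      ≈⟨ eq ⟩
      lincomb V d v                      ≈⟨ +ᴹ-identityˡ _ ⟨
      0ᴹ +ᴹ lincomb V d v                ∎)

module LinearForms {ℓ} (R : CommutativeRing ℓ ℓ) (V : LeftModule (CommutativeRing.ring R) ℓ ℓ) where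
  private module R = CommutativeRing R
  open LeftModule V
  open LinearCombinations R V

  scalars : LeftModule R.ring ℓ ℓ
  scalars = TensorUnit.leftModule

  private module Lincombᴿ = LinearCombinations R scalars

  record LinearForm : Set ℓ where
    infix 25 _·_
    field
      _·_    : Carrierᴹ → R.Carrier
      ·-cong : ∀ {x y} → x ≈ᴹ y → _·_ x R.≈ _·_ y
      ·-+    : ∀ x y → _·_ (x +ᴹ y) R.≈ _·_ x R.+ _·_ y
      ·-*    : ∀ s x → _·_ (s *ₗ x) R.≈ s R.* _·_ x

  open LinearForm

  module _ (f : LinearForm) where

    private module f = LinearForm f

    ·-0 : f · 0ᴹ R.≈ R.0#
    ·-0 = R.trans (f.·-cong (≈ᴹ-sym (*ₗ-zeroˡ 0ᴹ))) (R.trans (f.·-* R.0# 0ᴹ) (R.zeroˡ _))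

    ·-lincomb : ∀ {n} (c : Vector R.Carrier n) v → f · lincomb V c v R.≈ lincomb scalars c (λ i → f · v i)
    ·-lincomb {zero}  c v = ·-0
    ·-lincomb {suc n} c v = R.trans (f.·-+ _ _) (R.+-cong (f.·-* _ _) (·-lincomb (c ∘ suc) (v ∘ suc)))

    ·-- : ∀ x y → f · (x -ᴹ y) R.≈ f · x R.- f · y
    ·-- x y = R.trans (f.·-+ x (-ᴹ y)) (R.+-congˡ
      (R.trans (f.·-cong (≈ᴹ-sym (-1*x≈-x y))) (R.trans (f.·-* _ y) (Lincombᴿ.-1*x≈-x _))))

    Kernel : Pred Carrierᴹ ℓ
    Kernel x = f · x R.≈ R.0#

    kernel-isSubspace : IsSubspace V Kernel
    kernel-isSubspace = record
      { resp      = λ x≈y fx≈0 → R.trans (f.·-cong (≈ᴹ-sym x≈y)) fx≈0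
      ; 0-closed  = ·-0
      ; +-closed  = λ fx≈0 fy≈0 → R.trans (f.·-+ _ _) (R.trans (R.+-cong fx≈0 fy≈0) (R.+-identityˡ _))
      ; *ₗ-closed = λ s fx≈0 → R.trans (f.·-* s _) (R.trans (R.*-congˡ fx≈0) (R.zeroʳ s))
      }

  module _ (f : LinearForm) {x} (fx≈1 : f · x R.≈ R.1#) where

    y-[fy]x∈kernel : ∀ y → y -ᴹ (f · y) *ₗ x ∈ Kernel f
    y-[fy]x∈kernel y = R.trans (·-- f _ _) (R.trans
      (R.+-congˡ (R.-‿cong (R.trans (·-* f _ x) (R.trans (R.*-congˡ fx≈1) (R.*-identityʳ _)))))
      (R.-‿inverseʳ _))

    -- Split y into y - f(y)x, which lies in the kernel of f and hence of g, and f(y)x. Forms with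
    -- nested kernels are therefore scalar multiples of each other.
    kernel⊆⇒proportional : ∀ g → Kernel f ⊆ Kernel g → ∀ y → g · y R.≈ f · y R.* g · x
    kernel⊆⇒proportional g ker⊆ y =
      R.trans (·-cong g (≈ᴹ-sym (x-y+y≈x y ((f · y) *ₗ x))))
      (R.trans (·-+ g _ _)
      (R.trans (R.+-cong (ker⊆ (y-[fy]x∈kernel y)) (·-* g (f · y) x)) (R.+-identityˡ _)))

  module Coordinates {n} {v : Vector Carrierᴹ n} (v-indep : LinearlyIndependent V v) (v-spans : ∀ x → InSpan v x) where

    coordinates : Carrierᴹ → Vector R.Carrier n
    coordinates x = proj₁ (v-spans x)

    lincomb-coordinates : ∀ x → x ≈ᴹ lincomb V (coordinates x) v
    lincomb-coordinates x = proj₂ (v-spans x)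

    coordinates-unique : ∀ {x} {c} → x ≈ᴹ lincomb V c v → ∀ i → coordinates x i R.≈ c i
    coordinates-unique x≈cv = independent⇒injective {v = v} v-indep (≈ᴹ-trans (≈ᴹ-sym (lincomb-coordinates _)) x≈cv)

    -- The dual basis of `v`. The coefficients are only chosen by `v-spans`; their uniqueness makes
    -- the choice linear.
    coordinate : Fin n → LinearForm
    coordinate i = record
      { _·_    = λ x → coordinates x i
      ; ·-cong = λ x≈y → coordinates-unique (≈ᴹ-trans x≈y (lincomb-coordinates _)) i
      ; ·-+    = λ x y → coordinates-unique (≈ᴹ-trans (+ᴹ-cong (lincomb-coordinates x) (lincomb-coordinates y))
          (≈ᴹ-sym (lincomb-+ (coordinates x) (coordinates y) v))) i
      ; ·-*    = λ s x → coordinates-unique (≈ᴹ-trans (*ₗ-congˡ (lincomb-coordinates x))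
          (≈ᴹ-sym (lincomb-* s (coordinates x) v))) i
      }

    coordinates-basis : ∀ i j → coordinates (v i) j R.≈ unit i j
    coordinates-basis i = coordinates-unique (≈ᴹ-sym (lincomb-unit i v))

  -- The values `f i · x` act as the coefficients and `c` as the vectors, so that linearity in x is
  -- `lincomb-+` and `lincomb-*`.
  combineForms : ∀ {n} → Vector LinearForm n → Vector R.Carrier n → LinearForm
  combineForms f c = record
    { _·_    = λ x → lincomb scalars (λ i → f i · x) c
    ; ·-cong = λ x≈y → Lincombᴿ.lincomb-congˡ {v = c} (λ i → ·-cong (f i) x≈y)
    ; ·-+    = λ x y → R.trans (Lincombᴿ.lincomb-congˡ {v = c} (λ i → ·-+ (f i) x y)) (Lincombᴿ.lincomb-+ (λ i → f i · x) (λ i → f i · y) c)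
    ; ·-*    = λ s x → R.trans (Lincombᴿ.lincomb-congˡ {v = c} (λ i → ·-* (f i) s x)) (Lincombᴿ.lincomb-* s (λ i → f i · x) c)
    }

-- Bases and dimension over a finite field.

module FiniteVectorSpace {ℓ} {q N : ℕ} (R : CommutativeRing ℓ ℓ) (inverses : HasInverses R)
  (2≤q : 2 ≤ q) (∣R∣ : HasSize (CommutativeRing.setoid R) q)
  (V : LeftModule (CommutativeRing.ring R) ℓ ℓ) (∣V∣ : HasSize (LeftModule.≈ᴹ-setoid V) N)
  where

  private module R = CommutativeRing R
  open LeftModule V
  open LinearCombinations R V
  open LinearForms R V
  open LinearForm
  open Inverses R inverses
  open Subspace
  private
    module Fᴿ = Finite ∣R∣
    module Fⱽ = Finite ∣V∣
    module Lincombᴿ = LinearCombinations R scalars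
    module Fᶜ n = Finite (vectors-size ∣R∣ n)

  1≉0 : ¬ R.1# R.≈ R.0#
  1≉0 1≈0 = contradiction (ℕ.≤-trans 2≤q q≤1) λ { (s≤s ()) }
    where
    x≈0 : ∀ x → x R.≈ R.0#
    x≈0 x = R.trans (R.sym (R.*-identityˡ x)) (R.trans (R.*-congʳ 1≈0) (R.zeroˡ x))
    q≤1 : q ≤ 1
    q≤1 = injection⇒≤ ∣R∣ (≡-size 1) (λ _ → zero) (λ {x} {y} _ → R.trans (x≈0 x) (R.sym (x≈0 y)))

  *ₗ-cancel : ∀ {s x} → s *ₗ x ≈ᴹ 0ᴹ → ¬ s R.≈ R.0# → x ≈ᴹ 0ᴹ
  *ₗ-cancel {s} {x} sx≈0 s≉0 with invert s≉0
  ... | s⁻¹ , s⁻¹s≈1 = begin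
    x                   ≈⟨ *ₗ-identityˡ x ⟨
    R.1# *ₗ x           ≈⟨ *ₗ-congʳ s⁻¹s≈1 ⟨
    (s⁻¹ R.* s) *ₗ x    ≈⟨ *ₗ-assoc s⁻¹ s x ⟩
    s⁻¹ *ₗ s *ₗ x       ≈⟨ *ₗ-congˡ sx≈0 ⟩
    s⁻¹ *ₗ 0ᴹ           ≈⟨ *ₗ-zeroʳ s⁻¹ ⟩
    0ᴹ                  ∎
    where open ≈-Reasoning ≈ᴹ-setoid

  inSpan? : ∀ {n} (v : Vector Carrierᴹ n) → Decidable (InSpan v)
  inSpan? {n} v x = Fᶜ.any? n
    (λ c≈d x≈cv → ≈ᴹ-trans x≈cv (lincomb-congˡ {v = v} c≈d)) (λ c → x Fⱽ.≟ lincomb V c v)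

  independent-∷ : ∀ {n} {v : Vector Carrierᴹ n} {x} →
    LinearlyIndependent V v → ¬ InSpan v x → LinearlyIndependent V (x ∷ v)
  independent-∷ {v = v} {x} v-indep x∉span c cv≈0 = λ { zero → c₀≈0 ; (suc i) → v-indep (c ∘ suc) c′v≈0 i }
    where
    open ≈-Reasoning ≈ᴹ-setoid
    open IsSubspace (span-isSubspace v)
    c₀≈0 : c zero R.≈ R.0#
    c₀≈0 with c zero Fᴿ.≟ R.0#
    ... | yes c₀≈0 = c₀≈0
    ... | no  c₀≉0 = contradiction (resp (begin
        c₀⁻¹ *ₗ c zero *ₗ x    ≈⟨ *ₗ-assoc c₀⁻¹ _ x ⟨
        (c₀⁻¹ R.* c zero) *ₗ x ≈⟨ *ₗ-congʳ (proj₂ (invert c₀≉0)) ⟩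
        R.1# *ₗ x              ≈⟨ *ₗ-identityˡ x ⟩
        x                      ∎) (*ₗ-closed c₀⁻¹ c₀x∈span)) x∉span
      where
      c₀⁻¹ = proj₁ (invert c₀≉0)
      c₀x∈span : InSpan v (c zero *ₗ x)
      c₀x∈span = resp
        (≈ᴹ-trans (-1*x≈-x _) (≈ᴹ-sym (GroupProperties.inverseˡ-unique +ᴹ-group _ _ cv≈0)))
        (*ₗ-closed (R.- R.1#) (c ∘ suc , ≈ᴹ-refl))
    c′v≈0 : lincomb V (c ∘ suc) v ≈ᴹ 0ᴹ
    c′v≈0 = begin
      lincomb V (c ∘ suc) v                   ≈⟨ +ᴹ-identityˡ _ ⟨
      0ᴹ +ᴹ lincomb V (c ∘ suc) v             ≈⟨ +ᴹ-congʳ (≈ᴹ-trans (*ₗ-congʳ c₀≈0) (*ₗ-zeroˡ x)) ⟨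
      c zero *ₗ x +ᴹ lincomb V (c ∘ suc) v    ≈⟨ cv≈0 ⟩
      0ᴹ                                      ∎

  independent⇒q^n≤size : ∀ {W M n} {v : Vector Carrierᴹ n} → IsSubspace V W → HasSize (∃-setoid ≈ᴹ-setoid W) M →
    LinearlyIndependent V v → (∀ i → v i ∈ W) → q ^ n ≤ M
  independent⇒q^n≤size {n = n} {v} W ∣W∣ v-indep v∈W = injection⇒≤ (vectors-size ∣R∣ n) ∣W∣
    (λ c → lincomb V c v , lincomb-closed W c v∈W) (independent⇒injective {v = v} v-indep)

  independent⇒q^n≤N : ∀ {n} {v : Vector Carrierᴹ n} → LinearlyIndependent V v → q ^ n ≤ N
  independent⇒q^n≤N {n} {v} v-indep = injection⇒≤ (vectors-size ∣R∣ n) ∣V∣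
    (λ c → lincomb V c v) (independent⇒injective {v = v} v-indep)

  independent⇒spans : ∀ {n} {v : Vector Carrierᴹ n} → N ≡ q ^ n → LinearlyIndependent V v → ∀ x → InSpan v x
  independent⇒spans {n} {v} N≡q^n v-indep x = decidable-stable (inSpan? v x) λ x∉span →
    ℕ.<⇒≱ (ℕ.^-monoʳ-< q 2≤q (ℕ.n<1+n n))
      (ℕ.≤-trans (independent⇒q^n≤N {v = x ∷ v} (independent-∷ v-indep x∉span)) (ℕ.≤-reflexive N≡q^n))

  basis⇒size : ∀ {W n} {v : Vector Carrierᴹ n} → IsSubspace V W → IsBasis V W v →
    HasSize (∃-setoid ≈ᴹ-setoid W) (q ^ n)
  basis⇒size {W} {n} {v} W-sub v-basis = enumeration⇒HasSize (↔-id _)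
    (λ i → lincomb V (C.element i) v , lincomb-closed W-sub (C.element i) v.members)
    (λ eq → C.element-injective (independent⇒injective {v = v} v.independent eq))
    (λ (x , x∈W) → let c , x≈cv = v.spanning x∈W in
      C.index c , ≈ᴹ-trans x≈cv (lincomb-congˡ {v = v} λ i → R.sym (C.strictlyInverseʳ c i)))
    where
    module v = IsBasis v-basis
    module C = Fᶜ n

  member? : ∀ {d} (W : Subspace V d) → Decidable (members W)
  member? W x = map′
    (λ (c , x≈cv) → resp (≈ᴹ-sym x≈cv) (lincomb-closed W.isSubspace c b.members)) b.spanning
    (inSpan? W.basis x)
    where
    module W = Subspace W
    module b = IsBasis W.isBasis
    open IsSubspace W.isSubspace

  module _ {W : Pred Carrierᴹ ℓ} (W-sub : IsSubspace V W) (W? : Decidable W) where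

    -- Vectors of W outside the span are adjoined while the search finds one. The process stops
    -- because n independent vectors have q^n distinct combinations, so q^n is at most N. `P`
    -- carries along a property of the initial family, such as containing a given vector.
    extend-basis : (P : ∀ {n} → Vector Carrierᴹ n → Set ℓ) → (∀ {n x} {v : Vector Carrierᴹ n} → P v → P (x ∷ v)) →
      ∀ {n} {v : Vector Carrierᴹ n} → LinearlyIndependent V v → (∀ i → v i ∈ W) → P v →
      ∃[ d ] Σ[ u ∈ Vector Carrierᴹ d ] IsBasis V W u × P u
    extend-basis P P-∷ {n} {v} v-indep v∈W Pv =
      -- Fuel N suffices, since N < q^N; the invariant N < q^(fuel + n) becomes absurd when the fuel
      -- runs out.
      go N v-indep v∈W Pv (ℕ.<-≤-trans (n<m^n q N 2≤q) (ℕ.^-monoʳ-≤ q {{>-nonZero (ℕ.<⇒≤ 2≤q)}} (ℕ.m≤m+n N n)))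
      where
      go : ∀ fuel {n} {v : Vector Carrierᴹ n} → LinearlyIndependent V v → (∀ i → v i ∈ W) → P v → N < q ^ (fuel + n) →
        ∃[ d ] Σ[ u ∈ Vector Carrierᴹ d ] IsBasis V W u × P u
      go zero v-indep v∈W Pv N<q^n = contradiction (independent⇒q^n≤N v-indep) (ℕ.<⇒≱ N<q^n)
      go (suc fuel) {n} {v} v-indep v∈W Pv N<q^n
        with Fⱽ.any? (λ x≈y (x∈W , x∉span) → IsSubspace.resp W-sub x≈y x∈W ,
                        λ y∈span → x∉span (IsSubspace.resp (span-isSubspace v) (≈ᴹ-sym x≈y) y∈span))
                     (λ x → W? x ×-dec ¬? (inSpan? v x))
      ... | yes (x , x∈W , x∉span) =
        go fuel {v = x ∷ v} (independent-∷ v-indep x∉span) (λ { zero → x∈W ; (suc i) → v∈W i }) (P-∷ Pv)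
          (≡.subst (λ k → N < q ^ k) (≡.sym (ℕ.+-suc fuel n)) N<q^n)
      ... | no W∖span≡∅ = n , v , record
        { members     = v∈W
        ; independent = v-indep
        ; spanning    = λ {x} x∈W → decidable-stable (inSpan? v x) λ x∉span → W∖span≡∅ (x , x∈W , x∉span)
        } , Pv

    subspace-basis : ∃[ d ] Σ[ u ∈ Vector Carrierᴹ d ] IsBasis V W u
    subspace-basis with extend-basis (λ _ → ⊤) (λ _ → tt) {v = []} (λ _ _ ()) (λ ()) tt
    ... | d , u , u-basis , _ = d , u , u-basis

  -- Some basis exists by extension, and its length is forced, because q^n determines n when q is at
  -- least 2.
  size⇒basis : ∀ {W d} → IsSubspace V W → Decidable W → HasSize (∃-setoid ≈ᴹ-setoid W) (q ^ d) →
    Σ[ u ∈ Vector Carrierᴹ d ] IsBasis V W u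
  size⇒basis {W} {d} W-sub W? ∣W∣ with subspace-basis W-sub W?
  ... | n , u , u-basis with refl ← ^-cancelʳ-≡ q {n} {d} 2≤q (ℕ.≤-antisym
          (injection⇒≤ (basis⇒size W-sub u-basis) ∣W∣ id id)
          (injection⇒≤ ∣W∣ (basis⇒size W-sub u-basis) id id)) = u , u-basis

  size⇒Subspace : ∀ {W d} → IsSubspace V W → Decidable W → HasSize (∃-setoid ≈ᴹ-setoid W) (q ^ d) → Subspace V d
  size⇒Subspace {W} W-sub W? ∣W∣ = record
    { members    = W
    ; isSubspace = W-sub
    ; basis      = proj₁ (size⇒basis W-sub W? ∣W∣)
    ; isBasis    = proj₂ (size⇒basis W-sub W? ∣W∣)
    }

  -- Representatives of the points of P(R^n): the vectors whose first nonzero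
  -- coordinate is 1, which inj₁ places at the front.
  NormalVector : ℕ → Set
  NormalVector zero    = Fin 0
  NormalVector (suc n) = Fin (q ^ n) ⊎ NormalVector n

  repunit↔NormalVector : ∀ n → Fin (repunit q n) ↔ NormalVector n
  repunit↔NormalVector zero    = ↔-id (Fin 0)
  repunit↔NormalVector (suc n) = (↔-id (Fin (q ^ n)) ⊎-↔ repunit↔NormalVector n) ↔-∘ Fin.+↔⊎

  ⟦_⟧ : ∀ {n} → NormalVector n → Vector R.Carrier n
  ⟦_⟧ {suc n} (inj₁ i) = R.1# ∷ Fᶜ.element n i
  ⟦_⟧ {suc n} (inj₂ i) = R.0# ∷ ⟦ i ⟧

  ⟦⟧-nonzero : ∀ {n} (i : NormalVector n) → ¬ (∀ k → ⟦ i ⟧ k R.≈ R.0#)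
  ⟦⟧-nonzero {suc n} (inj₁ i) ≈0 = 1≉0 (≈0 zero)
  ⟦⟧-nonzero {suc n} (inj₂ i) ≈0 = ⟦⟧-nonzero i (≈0 ∘ suc)

  -- The leading entries decide: if both are 1 then s = 1, and a mixed pair would give 1 = 0 or a
  -- normal vector that vanishes.
  ⟦⟧-injective : ∀ {n} {i j : NormalVector n} s → (∀ k → ⟦ i ⟧ k R.≈ s R.* ⟦ j ⟧ k) → i ≡ j
  ⟦⟧-injective {suc n} {inj₁ i} {inj₁ j} s eq = ≡.cong inj₁ (Fᶜ.element-injective n λ k →
    R.trans (eq (suc k)) (R.trans (R.*-congʳ s≈1) (R.*-identityˡ _)))
    where s≈1 = R.trans (R.sym (R.*-identityʳ s)) (R.sym (eq zero))
  ⟦⟧-injective {suc n} {inj₁ i} {inj₂ j} s eq = contradiction (R.trans (eq zero) (R.zeroʳ s)) 1≉0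
  ⟦⟧-injective {suc n} {inj₂ i} {inj₁ j} s eq = contradiction
    (λ k → R.trans (eq (suc k)) (R.trans (R.*-congʳ s≈0) (R.zeroˡ _))) (⟦⟧-nonzero i)
    where s≈0 = R.trans (R.sym (R.*-identityʳ s)) (R.sym (eq zero))
  ⟦⟧-injective {suc n} {inj₂ i} {inj₂ j} s eq = ≡.cong inj₂ (⟦⟧-injective s (eq ∘ suc))

  normalise : ∀ {n} (c : Vector R.Carrier n) → ¬ (∀ k → c k R.≈ R.0#) →
    Σ[ i ∈ NormalVector n ] ∃[ s ] ¬ s R.≈ R.0# × (∀ k → c k R.≈ s R.* ⟦ i ⟧ k)
  normalise {zero}  c c≉0 = contradiction (λ ()) c≉0
  normalise {suc n} c c≉0 with c zero Fᴿ.≟ R.0#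
  ... | no c₀≉0 = inj₁ (Fᶜ.index n d) , c zero , c₀≉0 , λ
    { zero    → R.sym (R.*-identityʳ _)
    ; (suc k) → R.trans (c≈c₀d k) (R.*-congˡ (R.sym (Fᶜ.strictlyInverseʳ n d k))) }
    where
    c₀⁻¹ = proj₁ (invert c₀≉0)
    d : Vector R.Carrier n
    d k = c₀⁻¹ R.* c (suc k)
    c≈c₀d : ∀ k → c (suc k) R.≈ c zero R.* d k
    c≈c₀d k = begin
      c (suc k)                         ≈⟨ R.*-identityˡ _ ⟨
      R.1# R.* c (suc k)                ≈⟨ R.*-congʳ (proj₂ (invert c₀≉0)) ⟨
      (c₀⁻¹ R.* c zero) R.* c (suc k)   ≈⟨ R.*-congʳ (R.*-comm _ _) ⟩
      (c zero R.* c₀⁻¹) R.* c (suc k)   ≈⟨ R.*-assoc _ _ _ ⟩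
      c zero R.* d k                    ∎
      where open ≈-Reasoning R.setoid
  ... | yes c₀≈0 with normalise (c ∘ suc) (λ c′≈0 → c≉0 λ { zero → c₀≈0 ; (suc k) → c′≈0 k })
  ...   | i , s , s≉0 , eq = inj₂ i , s , s≉0 , λ
    { zero    → R.trans c₀≈0 (R.sym (R.zeroʳ s))
    ; (suc k) → eq k }

  -- Points and their number.

  module _ {x} (x≉0 : ¬ x ≈ᴹ 0ᴹ) where

    lineThrough : Subspace V 1
    lineThrough = record
      { members    = λ y → ∃[ s ] y ≈ᴹ s *ₗ x
      ; isSubspace = record
        { resp      = λ y≈z (s , y≈sx) → s , ≈ᴹ-trans (≈ᴹ-sym y≈z) y≈sx
        ; 0-closed  = R.0# , ≈ᴹ-sym (*ₗ-zeroˡ x)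
        ; +-closed  = λ (s , y≈sx) (t , z≈tx) → s R.+ t , ≈ᴹ-trans (+ᴹ-cong y≈sx z≈tx) (≈ᴹ-sym (*ₗ-distribʳ x s t))
        ; *ₗ-closed = λ t (s , y≈sx) → t R.* s , ≈ᴹ-trans (*ₗ-congˡ y≈sx) (≈ᴹ-sym (*ₗ-assoc t s x))
        }
      ; basis      = λ _ → x
      ; isBasis    = record
        { members     = λ _ → R.1# , ≈ᴹ-sym (*ₗ-identityˡ x)
        ; independent = λ c cx≈0 → λ { zero → decidable-stable (c zero Fᴿ.≟ R.0#) λ c≉0 →
            x≉0 (*ₗ-cancel (≈ᴹ-trans (≈ᴹ-sym (+ᴹ-identityʳ _)) cx≈0) c≉0) }
        ; spanning    = λ (s , y≈sx) → (λ _ → s) , ≈ᴹ-trans y≈sx (≈ᴹ-sym (+ᴹ-identityʳ _))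
        }
      }

  module Line (A : Subspace V 1) where

    private
      module A = Subspace A
      module b = IsBasis A.isBasis

    generator : Carrierᴹ
    generator = A.basis zero

    generator∈ : generator ∈ members A
    generator∈ = b.members zero

    ∈⇒multiple : ∀ {x} → x ∈ members A → ∃[ s ] x ≈ᴹ s *ₗ generator
    ∈⇒multiple x∈A = let c , x≈ = b.spanning x∈A in c zero , ≈ᴹ-trans x≈ (+ᴹ-identityʳ _)

    generator≉0 : ¬ generator ≈ᴹ 0ᴹ
    generator≉0 a≈0 = 1≉0 (b.independent (λ _ → R.1#)
      (≈ᴹ-trans (+ᴹ-identityʳ _) (≈ᴹ-trans (*ₗ-identityˡ _) a≈0)) zero)

    ⊆-generated : ∀ {W} → IsSubspace V W → generator ∈ W → members A ⊆ W
    ⊆-generated W a∈W x∈A = let s , x≈sa = ∈⇒multiple x∈A in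
      IsSubspace.resp W (≈ᴹ-sym x≈sa) (IsSubspace.*ₗ-closed W s a∈W)

  pointsIn : ∀ {d} → Subspace V d → Setoid (Level.suc ℓ) ℓ
  pointsIn W = record
    { Carrier       = Σ[ A ∈ Subspace V 1 ] members A ⊆ members W
    ; _≈_           = λ (A , _) (A′ , _) → members A ≐ members A′
    ; isEquivalence = record { refl = ≐-refl ; sym = ≐-sym ; trans = ≐-trans }
    }

  -- A point of W is spanned by a nonzero vector, whose coordinates in the basis of W are a nonzero
  -- multiple of exactly one normal vector.
  pointsIn-size : ∀ {d} (W : Subspace V d) → HasSize (pointsIn W) (repunit q d)
  pointsIn-size {d} W = enumeration⇒HasSize (repunit↔NormalVector d) point
    (λ {i} {j} (⊆ , _) → let s , eq = ⊆ (generated i) in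
      ⟦⟧-injective s (independent⇒injective {v = W.basis} b.independent
        (≈ᴹ-trans eq (≈ᴹ-sym (lincomb-* s ⟦ j ⟧ W.basis)))))
    surjective
    where
    module W = Subspace W
    module b = IsBasis W.isBasis
    vec : NormalVector d → Carrierᴹ
    vec i = lincomb V ⟦ i ⟧ W.basis
    vec≉0 : ∀ i → ¬ vec i ≈ᴹ 0ᴹ
    vec≉0 i eq = ⟦⟧-nonzero i (b.independent ⟦ i ⟧ eq)
    point : NormalVector d → Setoid.Carrier (pointsIn W)
    point i = lineThrough (vec≉0 i) , λ (s , x≈) →
      IsSubspace.resp W.isSubspace (≈ᴹ-sym x≈) (IsSubspace.*ₗ-closed W.isSubspace s (lincomb-closed W.isSubspace ⟦ i ⟧ b.members))
    generated : ∀ i → vec i ∈ members (proj₁ (point i))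
    generated i = R.1# , ≈ᴹ-sym (*ₗ-identityˡ _)
    surjective : ∀ A → ∃[ i ] Setoid._≈_ (pointsIn W) A (point i)
    surjective (A , A⊆W) with b.spanning (A⊆W (Line.generator∈ A))
    ... | c , a≈cv with normalise c (λ c≈0 → Line.generator≉0 A (≈ᴹ-trans a≈cv (lincomb-zero {v = W.basis} c≈0)))
    ...   | i , s , s≉0 , c≈s⟦i⟧ = i
            , Line.⊆-generated A (isSubspace (proj₁ (point i))) (s , a≈s*vec)
            , λ (t , x≈t*vec) → resp (≈ᴹ-sym x≈t*vec) (*ₗ-closed t vec∈A)
      where
      open IsSubspace (isSubspace A)
      s⁻¹ = proj₁ (invert s≉0)
      a≈s*vec : Line.generator A ≈ᴹ s *ₗ vec i
      a≈s*vec = ≈ᴹ-trans a≈cv (≈ᴹ-trans (lincomb-congˡ {v = W.basis} c≈s⟦i⟧) (lincomb-* s ⟦ i ⟧ W.basis))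
      vec∈A : vec i ∈ members A
      vec∈A = resp (begin
        s⁻¹ *ₗ Line.generator A  ≈⟨ *ₗ-congˡ a≈s*vec ⟩
        s⁻¹ *ₗ s *ₗ vec i       ≈⟨ *ₗ-assoc s⁻¹ s _ ⟨
        (s⁻¹ R.* s) *ₗ vec i    ≈⟨ *ₗ-congʳ (proj₂ (invert s≉0)) ⟩
        R.1# *ₗ vec i           ≈⟨ *ₗ-identityˡ _ ⟩
        vec i                   ∎) (*ₗ-closed s⁻¹ (Line.generator∈ A))
        where open ≈-Reasoning ≈ᴹ-setoid

  spans⇒N≤q^n : ∀ {n} {v : Vector Carrierᴹ n} → (∀ x → InSpan v x) → N ≤ q ^ n
  spans⇒N≤q^n {n} {v} v-spans = injection⇒≤ ∣V∣ (vectors-size ∣R∣ n) (λ x → proj₁ (v-spans x))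
    (λ {x} {y} c≈d → ≈ᴹ-trans (proj₂ (v-spans x)) (≈ᴹ-trans (lincomb-congˡ {v = v} c≈d) (≈ᴹ-sym (proj₂ (v-spans y)))))

  basis-length : ∀ {m n} {v : Vector Carrierᴹ n} → N ≡ q ^ m →
    LinearlyIndependent V v → (∀ x → InSpan v x) → n ≡ m
  basis-length N≡q^m v-indep v-spans = ^-cancelʳ-≡ q 2≤q (≡.trans
    (ℕ.≤-antisym (independent⇒q^n≤N v-indep) (spans⇒N≤q^n v-spans)) N≡q^m)

  -- Hyperplanes as kernels of linear forms.

  module Hyperplanes {m} (N≡q^1+m : N ≡ q ^ suc m) where

    -- Adjoining x to a basis of the kernel gives a basis of V, because y - f(y)x lies in the kernel
    -- for every y; comparing lengths gives d + 1 = m + 1.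
    kernel-basis : ∀ f {x} → f · x R.≈ R.1# → Σ[ u ∈ Vector Carrierᴹ m ] IsBasis V (Kernel f) u
    kernel-basis f {x} fx≈1 with subspace-basis (kernel-isSubspace f) (λ y → (f · y) Fᴿ.≟ R.0#)
    ... | d , u , u-basis = ≡.subst (λ d → Σ[ u ∈ Vector Carrierᴹ d ] IsBasis V (Kernel f) u) d≡m (u , u-basis)
      where
      module u = IsBasis u-basis
      x∉span : ¬ InSpan u x
      x∉span (c , x≈cu) = 1≉0 (R.trans (R.sym fx≈1)
        (IsSubspace.resp (kernel-isSubspace f) (≈ᴹ-sym x≈cu) (lincomb-closed (kernel-isSubspace f) c u.members)))
      x∷u-spans : ∀ y → InSpan (x ∷ u) y
      x∷u-spans y = let c , eq = u.spanning (y-[fy]x∈kernel f fx≈1 y) in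
        (f · y) ∷ c , ≈ᴹ-trans (≈ᴹ-sym (x-y+y≈x y _)) (≈ᴹ-trans (+ᴹ-comm _ _) (+ᴹ-congˡ eq))
      d≡m : d ≡ m
      d≡m = ℕ.suc-injective (basis-length {v = x ∷ u} N≡q^1+m (independent-∷ {v = u} u.independent x∉span) x∷u-spans)

    kernel : ∀ f {x} → f · x R.≈ R.1# → Subspace V m
    kernel f fx≈1 = record
      { members    = Kernel f
      ; isSubspace = kernel-isSubspace f
      ; basis      = proj₁ (kernel-basis f fx≈1)
      ; isBasis    = proj₂ (kernel-basis f fx≈1)
      }

    module _ (H : Subspace V m) where

      private
        module H = Subspace H
        module h = IsBasis H.isBasis

      ∃∉hyperplane : ∃[ w ] w ∉ members H
      ∃∉hyperplane = Fⱽ.¬∀⇒∃¬ (IsSubspace.resp H.isSubspace) (member? H) λ V⊆H →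
        ℕ.<⇒≱ (ℕ.^-monoʳ-< q 2≤q (ℕ.n<1+n m)) (ℕ.≤-trans (ℕ.≤-reflexive (≡.sym N≡q^1+m))
          (injection⇒≤ ∣V∣ (basis⇒size H.isSubspace H.isBasis) (λ x → x , V⊆H x) id))

      -- The form is the coordinate along a vector w outside H, in the basis of V made of w and a
      -- basis of H.
      hyperplane⇒kernel : ∃[ f ] ∃[ x ] f · x R.≈ R.1# × members H ≐ Kernel f
      hyperplane⇒kernel = coordinate zero , w , coordinates-basis zero zero
        , (λ x∈H → let c , x≈ch = h.spanning x∈H in
             coordinates-unique {c = R.0# ∷ c} (≈ᴹ-trans x≈ch
               (≈ᴹ-sym (≈ᴹ-trans (+ᴹ-congʳ (*ₗ-zeroˡ w)) (+ᴹ-identityˡ _)))) zero)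
        , λ {x} fx≈0 → IsSubspace.resp H.isSubspace
            (≈ᴹ-sym (≈ᴹ-trans (lincomb-coordinates x) (≈ᴹ-trans (+ᴹ-congʳ (≈ᴹ-trans (*ₗ-congʳ fx≈0) (*ₗ-zeroˡ w))) (+ᴹ-identityˡ _))))
            (lincomb-closed H.isSubspace (coordinates x ∘ suc) h.members)
        where
        w = proj₁ ∃∉hyperplane
        w∷h-independent : LinearlyIndependent V (w ∷ H.basis)
        w∷h-independent = independent-∷ {v = H.basis} h.independent λ (c , w≈ch) → proj₂ ∃∉hyperplane
          (IsSubspace.resp H.isSubspace (≈ᴹ-sym w≈ch) (lincomb-closed H.isSubspace c h.members))
        open Coordinates {v = w ∷ H.basis} w∷h-independent (independent⇒spans {v = w ∷ H.basis} N≡q^1+m w∷h-independent)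

    hyperplanesThrough : Subspace V 1 → Setoid (Level.suc ℓ) ℓ
    hyperplanesThrough A = record
      { Carrier       = Σ[ H ∈ Subspace V m ] members A ⊆ members H
      ; _≈_           = λ (H , _) (H′ , _) → members H ≐ members H′
      ; isEquivalence = record { refl = ≐-refl ; sym = ≐-sym ; trans = ≐-trans }
      }

    -- Extension puts new vectors in front, so the generator of A ends up at a position j that is
    -- known only to exist.
    basisThrough : ∀ A → Σ[ b ∈ Vector Carrierᴹ (suc m) ]
      LinearlyIndependent V b × (∀ x → InSpan b x) × ∃[ j ] b j ≈ᴹ Line.generator A
    basisThrough A
      with d , b , b-basis , a∈b ← extend-basis {W = λ _ → ⊤} _ (λ _ → yes tt)
        (λ v → ∃[ j ] v j ≈ᴹ Line.generator A) (λ (j , eq) → suc j , eq) {v = basis A}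
        (IsBasis.independent (isBasis A)) (λ _ → tt) (zero , ≈ᴹ-refl)
      with refl ← basis-length {suc m} N≡q^1+m (IsBasis.independent b-basis) (λ x → IsBasis.spanning b-basis tt)
      = b , IsBasis.independent b-basis , (λ x → IsBasis.spanning b-basis tt) , a∈b

    -- With the generator of A as the j-th basis vector, the forms vanishing on A are the
    -- combinations of the m other dual basis forms (`punchIn j` skips j), and a hyperplane
    -- determines its form up to a nonzero scalar.
    hyperplanesThrough-size : ∀ A → HasSize (hyperplanesThrough A) (repunit q m)
    hyperplanesThrough-size A with basisThrough A
    ... | b , b-indep , b-spans , j , bj≈a = enumeration⇒HasSize (repunit↔NormalVector m) hyperplane injective surjective
      where
      open Coordinates {v = b} b-indep b-spans

      form : Vector R.Carrier m → LinearForm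
      form = combineForms (coordinate ∘ Fin.punchIn j)

      unit-punchIn : ∀ k i → unit (Fin.punchIn j k) (Fin.punchIn j i) R.≈ unit k i
      unit-punchIn k i with k Fin.≟ i
      ... | yes refl = R.trans (unit-diagonal (Fin.punchIn j k)) (R.sym (unit-diagonal k))
      ... | no  k≢i  = R.trans (unit-offDiagonal (k≢i ∘ Fin.punchIn-injective j k i)) (R.sym (unit-offDiagonal k≢i))
      unit-j : ∀ i → unit j (Fin.punchIn j i) R.≈ R.0#
      unit-j i = unit-offDiagonal (Fin.punchInᵢ≢i j i ∘ ≡.sym)

      form-basis : ∀ c k → form c · b (Fin.punchIn j k) R.≈ c k
      form-basis c k = R.trans (Lincombᴿ.lincomb-congˡ {v = c} (λ i → R.trans (coordinates-basis (Fin.punchIn j k) _) (unit-punchIn k i)))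
        (Lincombᴿ.lincomb-unit k c)

      form-a : ∀ c → form c · Line.generator A R.≈ R.0#
      form-a c = R.trans (·-cong (form c) (≈ᴹ-sym bj≈a))
        (Lincombᴿ.lincomb-zero {v = c} (λ i → R.trans (coordinates-basis j _) (unit-j i)))

      form-preimage : ∀ i → ∃[ x ] form ⟦ i ⟧ · x R.≈ R.1#
      form-preimage i
        with k , ck≉0 ← Fin.¬∀⟶∃¬ m _ (λ k → ⟦ i ⟧ k Fᴿ.≟ R.0#) (⟦⟧-nonzero i) =
        let y , yc≈1 = invert ck≉0 in
        y *ₗ b (Fin.punchIn j k) ,
        R.trans (·-* (form ⟦ i ⟧) y _) (R.trans (R.*-congˡ (form-basis ⟦ i ⟧ k)) yc≈1)

      hyperplane : NormalVector m → Setoid.Carrier (hyperplanesThrough A)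
      hyperplane i = kernel (form ⟦ i ⟧) (proj₂ (form-preimage i))
        , Line.⊆-generated A (kernel-isSubspace (form ⟦ i ⟧)) (form-a ⟦ i ⟧)

      injective : ∀ {i i′} → Kernel (form ⟦ i ⟧) ≐ Kernel (form ⟦ i′ ⟧) → i ≡ i′
      -- Nested kernels make the two forms proportional, and evaluating at the basis vectors other
      -- than the j-th reads off their coefficients.
      injective {i} {i′} (_ , ker⊆) = let x , fx≈1 = form-preimage i′ in
        ⟦⟧-injective (form ⟦ i ⟧ · x) λ k → R.trans (R.sym (form-basis ⟦ i ⟧ k))
          (R.trans (kernel⊆⇒proportional (form ⟦ i′ ⟧) fx≈1 (form ⟦ i ⟧) ker⊆ (b (Fin.punchIn j k)))
          (R.trans (R.*-comm _ _) (R.*-congˡ (form-basis ⟦ i′ ⟧ k))))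

      f≈form : ∀ f → f · b j R.≈ R.0# → ∀ x → f · x R.≈ form (λ k → f · b (Fin.punchIn j k)) · x
      f≈form f fbj≈0 x = begin
        f · x                                   ≈⟨ ·-cong f (lincomb-coordinates x) ⟩
        f · lincomb V (coordinates x) b         ≈⟨ ·-lincomb f (coordinates x) b ⟩
        lincomb scalars (coordinates x) fb      ≈⟨ Sum.sum-remove R.+-commutativeMonoid {i = j} (λ i → coordinates x i R.* fb i) ⟩
        coordinates x j R.* fb j R.+ form c · x ≈⟨ R.+-congʳ (R.trans (R.*-congˡ fbj≈0) (R.zeroʳ _)) ⟩
        R.0# R.+ form c · x                     ≈⟨ R.+-identityˡ _ ⟩
        form c · x                              ∎
        where
        open ≈-Reasoning R.setoid
        fb : Vector R.Carrier (suc m)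
        fb i = f · b i
        c : Vector R.Carrier m
        c k = fb (Fin.punchIn j k)

      form-* : ∀ {c} s d → (∀ k → c k R.≈ s R.* d k) → ∀ x → form c · x R.≈ s R.* form d · x
      form-* s d c≈sd x = R.trans
        (Lincombᴿ.lincomb-cong {c = λ k → coordinates x (Fin.punchIn j k)} (λ _ → R.refl) c≈sd)
        (Lincombᴿ.lincomb-*ʳ s (λ k → coordinates x (Fin.punchIn j k)) d)

      normaliseForm : ∀ f → f · b j R.≈ R.0# → ∀ {w} → f · w R.≈ R.1# →
        ∃[ i ] ∃[ s ] ¬ s R.≈ R.0# × (∀ x → f · x R.≈ s R.* form ⟦ i ⟧ · x)
      normaliseForm f fbj≈0 {w} fw≈1
        with normalise (λ k → f · b (Fin.punchIn j k)) (λ c≈0 → 1≉0 (R.trans (R.sym fw≈1)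
               (R.trans (f≈form f fbj≈0 w) (Lincombᴿ.lincomb-zeroʳ (λ k → coordinates w (Fin.punchIn j k)) c≈0))))
      ... | i , s , s≉0 , c≈s⟦i⟧ = i , s , s≉0 , λ x → R.trans (f≈form f fbj≈0 x) (form-* s ⟦ i ⟧ c≈s⟦i⟧ x)

      surjective : ∀ H → ∃[ i ] Setoid._≈_ (hyperplanesThrough A) H (hyperplane i)
      surjective (H , A⊆H) =
        let f , w , fw≈1 , H⊆ker , ker⊆H = hyperplane⇒kernel H
            i , s , s≉0 , f≈sfᵢ = normaliseForm f (R.trans (·-cong f bj≈a) (H⊆ker (A⊆H (Line.generator∈ A)))) fw≈1
        in i
        , (λ {x} x∈H → *-cancelˡ-0 (R.trans (R.sym (f≈sfᵢ x)) (H⊆ker x∈H)) s≉0)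
        , (λ {x} fᵢx≈0 → ker⊆H (R.trans (f≈sfᵢ x) (R.trans (R.*-congˡ fᵢx≈0) (R.zeroʳ s))))

-- Binomial coefficients and the Frobenius map.

prime∤! : ∀ {p} → Prime p → ∀ {k} → k < p → ¬ p ∣ k !
prime∤! {p} p-prime {zero}  0<p p∣1 = ℕ.<⇒≱ (nonTrivial⇒n>1 p {{prime⇒nonTrivial p-prime}}) (∣⇒≤ p∣1)
prime∤! {p} p-prime {suc k} k<p p∣k! with euclidsLemma (suc k) (k !) p-prime p∣k!
... | inj₁ p∣1+k = ℕ.<⇒≱ k<p (∣⇒≤ p∣1+k)
... | inj₂ p∣k!′ = prime∤! p-prime (ℕ.<⇒≤ k<p) p∣k!′

-- The prime p divides p! = C(p,k) k! (p-k)! but neither of the two factorials, whose factors are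
-- all below p.
prime∣C : ∀ {p k} → Prime p → 0 < k → k < p → p ∣ p C k
prime∣C {suc p} {k} p-prime 0<k k<p
  with euclidsLemma (suc p C k) (k ! * (suc p ∸ k) !) p-prime (≡.subst (suc p ∣_) (≡.sym C*k!*[p-k]!≡p!) (m∣m*n (p !)))
  where
  instance _ = k ℕ.!* (suc p ∸ k) !≢0
  C*k!*[p-k]!≡p! : (suc p C k) * (k ! * (suc p ∸ k) !) ≡ suc p !
  C*k!*[p-k]!≡p! = ≡.trans (≡.cong (_* (k ! * (suc p ∸ k) !)) (nCk≡n!/k![n-k]! (ℕ.<⇒≤ k<p))) (m/n*n≡m (k![n∸k]!∣n! (ℕ.<⇒≤ k<p)))
... | inj₁ p∣C = p∣C
... | inj₂ p∣k!*[p-k]! with euclidsLemma (k !) ((suc p ∸ k) !) p-prime p∣k!*[p-k]!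
...   | inj₁ p∣k! = contradiction p∣k! (prime∤! p-prime k<p)
...   | inj₂ p∣[p-k]! = contradiction p∣[p-k]! (prime∤! p-prime (ℕ.∸-monoʳ-< 0<k (ℕ.<⇒≤ k<p)))

module Frobenius {ℓ} (R : CommutativeRing ℓ ℓ) {p} (p-prime : Prime p)
  (p×1≈0 : CommutativeRing._≈_ R (Mult._×_ (CommutativeRing.semiring R) p (CommutativeRing.1# R)) (CommutativeRing.0# R))
  where

  private module R = CommutativeRing R
  open CommutativeRing R using (Carrier; _≈_; 0#; 1#; setoid) renaming (_+_ to _⊕_; _*_ to _⊛_)
  open Mult R.semiring using () renaming (_×_ to _·_)
  open Exp R.commutativeSemiring using (^-assocʳ; ^-congˡ) renaming (_^_ to _↑_)
  open Mult R.semiring using (×-assocˡ; ×-assoc-*; ×-congʳ)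
  open Sum R.+-commutativeMonoid using (sum; sum-init-last; sum-cong-≋; sum-replicate-zero)
  open ≈-Reasoning setoid

  p∣n⇒n×x≈0 : ∀ {n} → p ∣ n → ∀ x → n · x ≈ 0#
  p∣n⇒n×x≈0 (divides m refl) x = begin
    (m * p) · x         ≈⟨ R.reflexive (≡.cong (_· x) (ℕ.*-comm m p)) ⟩
    (p * m) · x         ≈⟨ ×-assocˡ x p m ⟨
    p · (m · x)         ≈⟨ ×-congʳ p (R.*-identityˡ _) ⟨
    p · (1# ⊛ m · x)    ≈⟨ ×-assoc-* p 1# _ ⟨
    (p · 1#) ⊛ (m · x)  ≈⟨ R.*-congʳ p×1≈0 ⟩
    0# ⊛ (m · x)        ≈⟨ R.zeroˡ _ ⟩
    0#                  ∎

  ↑p-+ : ∀ x y → (x ⊕ y) ↑ p ≈ x ↑ p ⊕ y ↑ p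
  ↑p-+ x y = go p refl
    where
    -- Generalising p to n exposes the successor, so that the first and last binomial terms can be
    -- split off the sum.
    go : ∀ n → n ≡ p → (x ⊕ y) ↑ n ≈ x ↑ n ⊕ y ↑ n
    go zero    0≡p = contradiction (≡.sym 0≡p) (≢-nonZero⁻¹ p {{prime⇒nonZero p-prime}})
    go (suc n) eq = begin
      (x ⊕ y) ↑ suc n                              ≈⟨ Binomial.theorem R.commutativeSemiring (suc n) x y ⟩
      term zero ⊕ sum (λ k → term (suc k))         ≈⟨ R.+-congˡ (sum-init-last (λ k → term (suc k))) ⟩
      term zero ⊕ (sum middle ⊕ last)              ≈⟨ R.+-cong first≈ (R.+-cong middle≈0 last≈) ⟩
      y ↑ suc n ⊕ (0# ⊕ x ↑ suc n)                 ≈⟨ R.+-congˡ (R.+-identityˡ _) ⟩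
      y ↑ suc n ⊕ x ↑ suc n                        ≈⟨ R.+-comm _ _ ⟩
      x ↑ suc n ⊕ y ↑ suc n                        ∎
      where
      term = Binomial.binomialTerm R.commutativeSemiring x y (suc n)
      middle : Vector Carrier n
      middle = Vector.init (λ k → term (suc k))
      last = term (suc (Fin.fromℕ n))
      first≈ : term zero ≈ y ↑ suc n
      first≈ = R.trans (R.+-identityʳ _) (R.*-identityˡ _)
      last≈ : last ≈ x ↑ suc n
      last≈ = begin
        last                                            ≡⟨ ≡.cong (λ k → (suc n C suc k) · (x ↑ suc k ⊛ y ↑ (n ∸ k))) (Fin.toℕ-fromℕ n) ⟩
        (suc n C suc n) · (x ↑ suc n ⊛ y ↑ (n ∸ n))     ≡⟨ ≡.cong₂ (λ c k → c · (x ↑ suc n ⊛ y ↑ k)) (nCn≡1 (suc n)) (ℕ.n∸n≡0 n) ⟩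
        1 · (x ↑ suc n ⊛ 1#)                            ≈⟨ R.+-identityʳ _ ⟩
        x ↑ suc n ⊛ 1#                                  ≈⟨ R.*-identityʳ _ ⟩
        x ↑ suc n                                       ∎
      p∣middle : ∀ k → p ∣ suc n C suc (toℕ (Fin.inject₁ k))
      p∣middle k = ≡.subst (_∣ suc n C suc (toℕ (Fin.inject₁ k))) eq (prime∣C
        (≡.subst Prime (≡.sym eq) p-prime) (s≤s z≤n) (s≤s (≡.subst (_< n) (≡.sym (Fin.toℕ-inject₁ k)) (Fin.toℕ<n k))))
      middle≈0 : sum middle ≈ 0#
      middle≈0 = R.trans (sum-cong-≋ (λ k → p∣n⇒n×x≈0 (p∣middle k) _)) (sum-replicate-zero n)

  ↑p^n-+ : ∀ n x y → (x ⊕ y) ↑ (p ^ n) ≈ x ↑ (p ^ n) ⊕ y ↑ (p ^ n)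
  ↑p^n-+ zero    x y = R.trans (R.*-identityʳ _) (R.+-cong (R.sym (R.*-identityʳ x)) (R.sym (R.*-identityʳ y)))
  ↑p^n-+ (suc n) x y = begin
    (x ⊕ y) ↑ (p * p ^ n)                           ≈⟨ ^-assocʳ (x ⊕ y) p (p ^ n) ⟨
    ((x ⊕ y) ↑ p) ↑ (p ^ n)                         ≈⟨ ^-congˡ (p ^ n) (↑p-+ x y) ⟩
    (x ↑ p ⊕ y ↑ p) ↑ (p ^ n)                       ≈⟨ ↑p^n-+ n (x ↑ p) (y ↑ p) ⟩
    (x ↑ p) ↑ (p ^ n) ⊕ (y ↑ p) ↑ (p ^ n)           ≈⟨ R.+-cong (^-assocʳ x p (p ^ n)) (^-assocʳ y p (p ^ n)) ⟩
    x ↑ (p * p ^ n) ⊕ y ↑ (p * p ^ n)               ∎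

-- Finite fields: inverses, characteristic, and x^N = x.

sum-reindex : ∀ {c ℓ₁ a b} (M : CommutativeMonoid c ℓ₁) (let module M = CommutativeMonoid M) {S : Setoid a b} (let module S = Setoid S)
  {n} (∣S∣ : HasSize S n) (f : S.Carrier → M.Carrier) → (∀ {x y} → x S.≈ y → f x M.≈ f y) →
  (π π⁻¹ : S.Carrier → S.Carrier) → (∀ {x y} → x S.≈ y → π x S.≈ π y) → (∀ {x y} → x S.≈ y → π⁻¹ x S.≈ π⁻¹ y) →
  (∀ x → π (π⁻¹ x) S.≈ x) → (∀ x → π⁻¹ (π x) S.≈ x) →
  (let open Finite ∣S∣ using (element); open Sum M using (sum)) →
  sum (λ i → f (element i)) M.≈ sum (λ i → f (π (element i)))
sum-reindex M {S} {n} ∣S∣ f f-cong π π⁻¹ π-cong π⁻¹-cong ππ⁻¹ π⁻¹π = M.trans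
  (Sum.sum-permute M (λ i → f (element i)) (permutation (conjugate π) (conjugate π⁻¹)
    (conjugate-inverse π-cong ππ⁻¹) (conjugate-inverse π⁻¹-cong π⁻¹π)))
  (Sum.sum-cong-≋ M {n} (λ i → f-cong (strictlyInverseʳ (π (element i)))))
  where
  module M = CommutativeMonoid M
  module S = Setoid S
  open Finite ∣S∣
  -- The map acts on indices by conjugation with the enumeration, which turns a bijection of the
  -- setoid into a permutation of `Fin n`.
  conjugate : (S.Carrier → S.Carrier) → Fin _ → Fin _
  conjugate π i = index (π (element i))
  conjugate-inverse : ∀ {σ τ} → (∀ {x y} → x S.≈ y → σ x S.≈ σ y) → (∀ x → σ (τ x) S.≈ x) →
    ∀ i → conjugate σ (conjugate τ i) ≡ i
  conjugate-inverse σ-cong στ i = ≡.trans (to-cong (S.trans (σ-cong (strictlyInverseʳ _)) (στ _))) (strictlyInverseˡ i)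

module FiniteField {ℓ} (F : Field ℓ) {N} (∣F∣ : HasSize (Field.setoid F) N) where

  private
    module F = Field F
    module H = HeytingField F
  open Field F using (Carrier; _≈_; 0#; 1#; setoid; _↑_) renaming (_+_ to _⊕_; _*_ to _⊛_; -_ to ⊖_)
  open Finite ∣F∣
  open Mult F.semiring using () renaming (_×_ to _·_)
  open ≈-Reasoning setoid

  -- Apartness itself is not decided; a search for an inverse is. If there were none, x # 0 would be
  -- refuted, and tightness would give x = 0.
  inverses : HasInverses F.commutativeRing
  inverses x x≉0 = decidable-stable
    (any? (λ y≈z yx≈1 → F.trans (F.*-congʳ (F.sym y≈z)) yx≈1) (λ y → (y ⊛ x) ≟ 1#))
    λ noninvertible → x≉0 (proj₁ (H.tight x 0#) λ x#0 →
      let y , y[x-0]≈1 , _ = H.#⇒invertible x#0 in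
      noninvertible (y , F.trans (F.*-congˡ (F.sym (x-0≈x))) y[x-0]≈1))
    where
    x-0≈x : x ⊕ ⊖ 0# ≈ x
    x-0≈x = F.trans (F.+-congˡ (GroupProperties.ε⁻¹≈ε F.+-group)) (F.+-identityʳ x)

  open Inverses F.commutativeRing inverses public

  ↑n≈0⇒≈0 : ∀ {x} n → x ↑ n ≈ 0# → x ≈ 0#
  ↑n≈0⇒≈0 {x} zero    1≈0 = F.trans (F.sym (F.*-identityʳ x)) (F.trans (F.*-congˡ 1≈0) (F.zeroʳ x))
  ↑n≈0⇒≈0 {x} (suc n) eq  = decidable-stable (x ≟ 0#) λ x≉0 → x≉0 (↑n≈0⇒≈0 n (*-cancelˡ-0 eq x≉0))

  *-cancelʳ : ∀ {x y z} → ¬ z ≈ 0# → x ⊛ z ≈ y ⊛ z → x ≈ y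
  *-cancelʳ {x} {y} {z} z≉0 xz≈yz with invert z≉0
  ... | z⁻¹ , z⁻¹z≈1 = F.trans (F.sym (cancel x)) (F.trans (F.*-congʳ xz≈yz) (cancel y))
    where
    cancel : ∀ x → (x ⊛ z) ⊛ z⁻¹ ≈ x
    cancel x = F.trans (F.*-assoc x z z⁻¹) (F.trans (F.*-congˡ (F.trans (F.*-comm z z⁻¹) z⁻¹z≈1)) (F.*-identityʳ x))

  -- Translation by 1 permutes F, so the sum of all elements is unchanged when N · 1 is added to it.
  N×1≈0 : N · 1# ≈ 0#
  N×1≈0 = G.∙-cancelˡ (sum element) _ _ (begin
    sum element ⊕ N · 1#             ≈⟨ F.+-congˡ (sum-replicate N) ⟨
    sum element ⊕ sum (λ (_ : Fin N) → 1#)       ≈⟨ ∑-distrib-+ element (λ _ → 1#) ⟨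
    sum (λ i → element i ⊕ 1#)       ≈⟨ sum-reindex F.+-commutativeMonoid ∣F∣ id id (_⊕ 1#) (_⊕ ⊖ 1#)
                                          F.+-congʳ F.+-congʳ (G.//-rightDividesˡ 1#) (G.//-rightDividesʳ 1#) ⟨
    sum element                      ≈⟨ F.+-identityʳ _ ⟨
    sum element ⊕ 0#                 ∎)
    where
    module G = GroupProperties F.+-group
    open Sum F.+-commutativeMonoid using (sum; sum-replicate; ∑-distrib-+)

  -- In the ring, (p · 1)^e = p^e · 1 = N · 1 = 0, and a field has no nonzero nilpotent element.
  characteristic : ∀ {p e} → N ≡ p ^ e → p · 1# ≈ 0#
  characteristic {p} {e} refl = ↑n≈0⇒≈0 e (F.trans (F.sym (×1-homo-^ e)) N×1≈0)
    where
    ×1-homo-^ : ∀ e → (p ^ e) · 1# ≈ (p · 1#) ↑ e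
    ×1-homo-^ zero    = F.+-identityʳ 1#
    ×1-homo-^ (suc e) = F.trans (Mult.×1-homo-* F.semiring p (p ^ e)) (F.*-congˡ (×1-homo-^ e))

  private
    -- The contribution of 0 is replaced by 1, so that a product over the nonzero elements becomes
    -- one over the whole field, to which `sum-reindex` applies.
    ifNonzero : Carrier → Carrier → Carrier
    ifNonzero x y with x ≟ 0#
    ... | yes _ = 1#
    ... | no  _ = y

    ifNonzero-≉0 : ∀ {x y} → ¬ x ≈ 0# → ifNonzero x y ≈ y
    ifNonzero-≉0 {x} x≉0 with x ≟ 0#
    ... | yes x≈0 = contradiction x≈0 x≉0
    ... | no  _   = F.refl

    ifNonzero-≈0 : ∀ {x y} → x ≈ 0# → ifNonzero x y ≈ 1#
    ifNonzero-≈0 {x} x≈0 with x ≟ 0#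
    ... | yes _   = F.refl
    ... | no  x≉0 = contradiction x≈0 x≉0

  -- Multiplication by x ≉ 0 permutes F, so the product of all nonzero elements is
  -- unchanged when each factor is multiplied by x.
  ↑N≈ : ∀ x → x ↑ N ≈ x
  ↑N≈ x with x ≟ 0#
  ... | yes x≈0 = go (index 0#)
    where
    -- The index of 0 inhabits `Fin N`, which shows that N is a successor and so that the power of 0
    -- is 0.
    go : ∀ {N} → Fin N → x ↑ N ≈ x
    go {suc n} _ = F.trans (F.*-congʳ x≈0) (F.trans (F.zeroˡ _) (F.sym x≈0))
  ... | no  x≉0 = begin
    x ↑ N                                     ≈⟨ x*factors≈x↑n element (index 0#) (strictlyInverseʳ 0#)
                                                   (λ j j≢i xⱼ≈0 → j≢i (≡.trans (≡.sym (strictlyInverseˡ j)) (to-cong xⱼ≈0))) ⟨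
    x ⊛ product (λ i → factor (element i))    ≈⟨ F.*-congˡ factors≈1 ⟨
    x ⊛ 1#                                    ≈⟨ F.*-identityʳ x ⟩
    x                                         ∎
    where
    open Sum F.*-commutativeMonoid using (sum-remove; sum-cong-≋; sum-replicate; ∑-distrib-+) renaming (sum to product)
    factor nonzero : Carrier → Carrier
    factor y  = ifNonzero y x
    nonzero y = ifNonzero y y

    1≉0 : ¬ 1# ≈ 0#
    1≉0 1≈0 = x≉0 (F.trans (F.sym (F.*-identityʳ x)) (F.trans (F.*-congˡ 1≈0) (F.zeroʳ x)))

    product≉0 : ∀ {n} (v : Vector Carrier n) → (∀ i → ¬ v i ≈ 0#) → ¬ product v ≈ 0#
    product≉0 {zero}  v v≉0 = 1≉0
    product≉0 {suc n} v v≉0 eq = product≉0 (v ∘ suc) (v≉0 ∘ suc) (*-cancelˡ-0 eq (v≉0 zero))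

    nonzero≉0 : ∀ y → ¬ nonzero y ≈ 0#
    nonzero≉0 y eq with y ≟ 0#
    ... | yes _   = 1≉0 eq
    ... | no  y≉0 = y≉0 eq

    nonzero-cong : ∀ {y z} → y ≈ z → nonzero y ≈ nonzero z
    nonzero-cong {y} {z} y≈z with y ≟ 0#
    ... | yes y≈0 = F.sym (ifNonzero-≈0 (F.trans (F.sym y≈z) y≈0))
    ... | no  y≉0 = F.trans y≈z (F.sym (ifNonzero-≉0 (y≉0 ∘ F.trans y≈z)))

    nonzero-* : ∀ y → nonzero (x ⊛ y) ≈ factor y ⊛ nonzero y
    nonzero-* y with y ≟ 0#
    ... | yes y≈0 = F.trans (ifNonzero-≈0 (F.trans (F.*-congˡ y≈0) (F.zeroʳ x))) (F.sym (F.*-identityˡ 1#))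
    ... | no  y≉0 = ifNonzero-≉0 (λ xy≈0 → y≉0 (*-cancelˡ-0 xy≈0 x≉0))

    -- The single zero entry contributes 1 and each of the others x, so the product is one factor x
    -- short of x^n; the x in front supplies it.
    x*factors≈x↑n : ∀ {n} (v : Vector Carrier n) i → v i ≈ 0# → (∀ j → j ≢ i → ¬ v j ≈ 0#) →
      x ⊛ product (λ j → factor (v j)) ≈ x ↑ n
    x*factors≈x↑n {suc n} v i vᵢ≈0 v≉0 = F.*-congˡ (begin
      product (λ j → factor (v j))                        ≈⟨ sum-remove {i = i} (λ j → factor (v j)) ⟩
      factor (v i) ⊛ product (λ j → factor (v (Fin.punchIn i j))) ≈⟨ F.*-cong (ifNonzero-≈0 vᵢ≈0)
          (sum-cong-≋ (λ j → ifNonzero-≉0 (v≉0 _ (Fin.punchInᵢ≢i i j)))) ⟩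
      1# ⊛ product (λ (_ : Fin n) → x)                    ≈⟨ F.*-identityˡ _ ⟩
      product (λ (_ : Fin n) → x)                         ≈⟨ sum-replicate n ⟩
      x ↑ n                                               ∎)

    factors≈1 : 1# ≈ product (λ i → factor (element i))
    factors≈1 with x⁻¹ , x⁻¹x≈1 ← invert x≉0 =
      *-cancelʳ (product≉0 (λ i → nonzero (element i)) (λ i → nonzero≉0 (element i))) (begin
      1# ⊛ product (λ i → nonzero (element i))          ≈⟨ F.*-identityˡ _ ⟩
      product (λ i → nonzero (element i))               ≈⟨ sum-reindex F.*-commutativeMonoid ∣F∣ nonzero nonzero-cong (x ⊛_) (x⁻¹ ⊛_)
                                                             F.*-congˡ F.*-congˡ
                                                             (cancel (F.trans (F.*-comm x x⁻¹) x⁻¹x≈1)) (cancel x⁻¹x≈1) ⟩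
      product (λ i → nonzero (x ⊛ element i))           ≈⟨ sum-cong-≋ (λ i → nonzero-* (element i)) ⟩
      product (λ i → factor (element i) ⊛ nonzero (element i)) ≈⟨ ∑-distrib-+ (λ i → factor (element i)) (λ i → nonzero (element i)) ⟩
      product (λ i → factor (element i)) ⊛ product (λ i → nonzero (element i)) ∎)
      where
      cancel : ∀ {y z} → y ⊛ z ≈ 1# → ∀ w → y ⊛ (z ⊛ w) ≈ w
      cancel yz≈1 w = F.trans (F.sym (F.*-assoc _ _ w)) (F.trans (F.*-congʳ yz≈1) (F.*-identityˡ w))

-- The cyclic multiplicative group, its cosets and the subfield.

module CyclicField {ℓ} (F : Field ℓ) {N} (∣F∣ : HasSize (Field.setoid F) (suc N)) .{{_ : NonZero N}}
  {α : Field.Carrier F} (α-generates : IsGenerator F α) where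

  private module F = Field F
  open Field F using (Carrier; _≈_; 0#; 1#; setoid; _↑_) renaming (_+_ to _⊕_; _*_ to _⊛_)
  open Finite ∣F∣
  open FiniteField F ∣F∣
  open Exp F.commutativeSemiring using (^-assocʳ; ^-homo-*; ^-congˡ; ^-distrib-*)
  open ≈-Reasoning setoid

  α≉0 : ¬ α ≈ 0#
  α≉0 = proj₁ α-generates

  α↑≉0 : ∀ n → ¬ α ↑ n ≈ 0#
  α↑≉0 n = α≉0 ∘ ↑n≈0⇒≈0 n

  ↑-*-≈1 : ∀ {x} d → x ↑ d ≈ 1# → ∀ n → x ↑ (n * d) ≈ 1#
  ↑-*-≈1 d eq zero    = F.refl
  ↑-*-≈1 {x} d eq (suc n) = F.trans (^-homo-* x d (n * d)) (F.trans (F.*-cong eq (↑-*-≈1 d eq n)) (F.*-identityˡ 1#))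

  ↑-% : ∀ {x} d .{{_ : NonZero d}} → x ↑ d ≈ 1# → ∀ n → x ↑ n ≈ x ↑ (n % d)
  ↑-% {x} d eq n = begin
    x ↑ n                               ≡⟨ ≡.cong (x ↑_) (m≡m%n+[m/n]*n n d) ⟩
    x ↑ (n % d + n / d * d)             ≈⟨ ^-homo-* x (n % d) (n / d * d) ⟩
    x ↑ (n % d) ⊛ x ↑ (n / d * d)       ≈⟨ F.*-congˡ (↑-*-≈1 d eq (n / d)) ⟩
    x ↑ (n % d) ⊛ 1#                    ≈⟨ F.*-identityʳ _ ⟩
    x ↑ (n % d)                         ∎

  ↑N≈1 : ∀ {x} → ¬ x ≈ 0# → x ↑ N ≈ 1#
  ↑N≈1 {x} x≉0 = *-cancelʳ x≉0 (begin
    x ↑ N ⊛ x  ≈⟨ F.*-comm _ x ⟩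
    x ⊛ x ↑ N  ≈⟨ ↑N≈ x ⟩
    x          ≈⟨ F.*-identityˡ x ⟨
    1# ⊛ x     ∎)

  -- If α^d = 1, reducing exponents modulo d leaves at most d nonzero elements, hence at most d + 1
  -- elements in all, against N + 1.
  α↑d≈1⇒N≤d : ∀ d .{{_ : NonZero d}} → α ↑ d ≈ 1# → N ≤ d
  α↑d≈1⇒N≤d d α↑d≈1 = s≤s⁻¹ (injection⇒≤ ∣F∣ (≡-size (suc d)) code code-injective)
    where
    code : Carrier → Fin (suc d)
    code x with x ≟ 0#
    ... | yes _   = zero
    ... | no  x≉0 = suc (Fin.fromℕ< (m%n<n (proj₁ (proj₂ α-generates x x≉0)) d))
    code-injective : ∀ {x y} → code x ≡ code y → x ≈ y
    code-injective {x} {y} eq with x ≟ 0# | y ≟ 0#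
    ... | yes x≈0 | yes y≈0 = F.trans x≈0 (F.sym y≈0)
    ... | no  x≉0 | no  y≉0 = let n , x≈ = proj₂ α-generates x x≉0 ; n′ , y≈ = proj₂ α-generates y y≉0 in begin
      x              ≈⟨ x≈ ⟩
      α ↑ n          ≈⟨ ↑-% d α↑d≈1 n ⟩
      α ↑ (n % d)    ≡⟨ ≡.cong (α ↑_) (≡.trans (≡.sym (Fin.toℕ-fromℕ< _))
                          (≡.trans (≡.cong toℕ (Fin.suc-injective eq)) (Fin.toℕ-fromℕ< _))) ⟩
      α ↑ (n′ % d)   ≈⟨ ↑-% d α↑d≈1 n′ ⟨
      α ↑ n′         ≈⟨ y≈ ⟨
      y              ∎

  log : ∀ {x} → ¬ x ≈ 0# → ∃[ n ] n < N × x ≈ α ↑ n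
  log {x} x≉0 = let n , x≈ = proj₂ α-generates x x≉0 in
    n % N , m%n<n n N , F.trans x≈ (↑-% N (↑N≈1 α≉0) n)

  private
    α↑-≮ : ∀ {r s} → s < N → α ↑ r ≈ α ↑ s → ¬ r < s
    α↑-≮ {r} {s} s<N eq r<s = ℕ.<⇒≱ s<N (ℕ.≤-trans
      (α↑d≈1⇒N≤d (s ∸ r) {{>-nonZero (ℕ.m<n⇒0<n∸m r<s)}} (*-cancelʳ (α↑≉0 r) (begin
        α ↑ (s ∸ r) ⊛ α ↑ r  ≈⟨ ^-homo-* α (s ∸ r) r ⟨
        α ↑ (s ∸ r + r)      ≡⟨ ≡.cong (α ↑_) (ℕ.m∸n+n≡m (ℕ.<⇒≤ r<s)) ⟩
        α ↑ s                ≈⟨ eq ⟨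
        α ↑ r                ≈⟨ F.*-identityˡ _ ⟨
        1# ⊛ α ↑ r           ∎)))
      (ℕ.m∸n≤m s r))

  α↑-injective : ∀ {r s} → r < N → s < N → α ↑ r ≈ α ↑ s → r ≡ s
  α↑-injective {r} {s} r<N s<N eq with ℕ.<-cmp r s
  ... | tri< r<s _ _ = contradiction r<s (α↑-≮ s<N eq)
  ... | tri≈ _ r≡s _ = r≡s
  ... | tri> _ _ s<r = contradiction s<r (α↑-≮ r<N (F.sym eq))

  -- For N = β * n, the residue classes of exponents modulo β, as in S of the construction.
  module Cosets (β n : ℕ) .{{_ : NonZero β}} .{{_ : NonZero n}} (β*n≡N : β * n ≡ N) where

    Coset : ℕ → Pred Carrier ℓ
    Coset i x = ∃[ j ] j < n × x ≈ α ↑ (i + j * β)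

    j*β<N : ∀ {i j} → i < β → j < n → i + j * β < N
    j*β<N {i} {j} i<β j<n = ≤.begin-strict
      i + j * β     ≤.<⟨ ℕ.+-monoˡ-< (j * β) i<β ⟩
      suc j * β     ≤.≤⟨ ℕ.*-monoˡ-≤ β j<n ⟩
      n * β         ≤.≡⟨ ≡.trans (ℕ.*-comm n β) β*n≡N ⟩
      N             ≤.∎
      where module ≤ = ℕ.≤-Reasoning

    α↑[β*n]≈1 : (α ↑ β) ↑ n ≈ 1#
    α↑[β*n]≈1 = F.trans (^-assocʳ α β n) (F.trans (F.reflexive (≡.cong (α ↑_) β*n≡N)) (↑N≈1 α≉0))

    α↑[i+jβ]≈ : ∀ i j → α ↑ (i + j * β) ≈ α ↑ i ⊛ (α ↑ β) ↑ j
    α↑[i+jβ]≈ i j = F.trans (^-homo-* α i (j * β)) (F.*-congˡ (F.trans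
      (F.reflexive (≡.cong (α ↑_) (ℕ.*-comm j β))) (F.sym (^-assocʳ α β j))))

    α↑∈Coset : ∀ {x} i j → x ≈ α ↑ (i + j * β) → x ∈ Coset i
    α↑∈Coset {x} i j x≈ = j % n , m%n<n j n , (begin
      x                               ≈⟨ x≈ ⟩
      α ↑ (i + j * β)                 ≈⟨ α↑[i+jβ]≈ i j ⟩
      α ↑ i ⊛ (α ↑ β) ↑ j             ≈⟨ F.*-congˡ (↑-% n α↑[β*n]≈1 j) ⟩
      α ↑ i ⊛ (α ↑ β) ↑ (j % n)       ≈⟨ α↑[i+jβ]≈ i (j % n) ⟨
      α ↑ (i + j % n * β)             ∎)

    coset : ∀ {x} → ¬ x ≈ 0# → ∃[ i ] i < β × x ∈ Coset i
    coset x≉0 = let s , s<N , x≈ = log x≉0 in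
      s % β , m%n<n s β , α↑∈Coset (s % β) (s / β)
        (F.trans x≈ (F.reflexive (≡.cong (α ↑_) (m≡m%n+[m/n]*n s β))))

    cosets-disjoint : ∀ {x i i′} → i < β → i′ < β → x ∈ Coset i → x ∈ Coset i′ → i ≡ i′
    cosets-disjoint {x} {i} {i′} i<β i′<β (j , j<n , x≈) (j′ , j′<n , x≈′) =
      ≡.trans (≡.sym (m<n⇒m%n≡m i<β)) (≡.trans (≡.sym ([m+kn]%n≡m%n i j β)) (≡.trans
        (≡.cong (_% β) (α↑-injective (j*β<N i<β j<n) (j*β<N i′<β j′<n) (F.trans (F.sym x≈) x≈′)))
        (≡.trans ([m+kn]%n≡m%n i′ j′ β) (m<n⇒m%n≡m i′<β))))

    -- The roots of X^(n+1) - X; n + 1 becomes q^(k+1). This description is decidable and visibly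
    -- multiplicative, and its nonzero part is shown to be coset 0.
    InSubfield : Pred Carrier ℓ
    InSubfield x = x ↑ suc n ≈ x

    Coset₀⇒InSubfield : ∀ {x} → x ∈ Coset 0 → InSubfield x
    Coset₀⇒InSubfield {x} x∈@(j , _ , x≈) = F.trans (F.*-congˡ (begin
      x ↑ n                    ≈⟨ ^-congˡ n x≈ ⟩
      (α ↑ (j * β)) ↑ n        ≈⟨ ^-assocʳ α (j * β) n ⟩
      α ↑ (j * β * n)          ≡⟨ ≡.cong (α ↑_) (≡.trans (ℕ.*-assoc j β n) (≡.cong (j *_) β*n≡N)) ⟩
      α ↑ (j * N)              ≈⟨ ↑-*-≈1 N (↑N≈1 α≉0) j ⟩
      1#                       ∎)) (F.*-identityʳ x)

    -- A nonzero such x has x^n = 1. If x lies in coset i, then α^(i n) = 1 as well, since (α^β)^n =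
    -- 1; for 0 < i < β the exponent i n lies strictly between 0 and the order N of α.
    InSubfield⇒Coset₀ : ∀ {x} → InSubfield x → ¬ x ≈ 0# → x ∈ Coset 0
    InSubfield⇒Coset₀ {x} x↑1+n≈x x≉0 with coset x≉0
    ... | zero  , _   , x∈ = x∈
    ... | suc i , i<β , j , j<n , x≈ = contradiction (ℕ.*-monoˡ-< n i<β) (ℕ.≤⇒≯ (ℕ.≤-trans (ℕ.≤-reflexive β*n≡N)
        (α↑d≈1⇒N≤d (suc i * n) {{ℕ.m*n≢0 (suc i) n}} (begin
      α ↑ (suc i * n)                           ≈⟨ ^-assocʳ α (suc i) n ⟨
      (α ↑ suc i) ↑ n                           ≈⟨ F.*-identityʳ _ ⟨
      (α ↑ suc i) ↑ n ⊛ 1#                      ≈⟨ F.*-congˡ (F.trans (^-assocʳ (α ↑ β) j n) (↑-*-≈1 n α↑[β*n]≈1 j)) ⟨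
      (α ↑ suc i) ↑ n ⊛ ((α ↑ β) ↑ j) ↑ n       ≈⟨ ^-distrib-* (α ↑ suc i) ((α ↑ β) ↑ j) n ⟨
      (α ↑ suc i ⊛ (α ↑ β) ↑ j) ↑ n             ≈⟨ ^-congˡ n (F.trans x≈ (α↑[i+jβ]≈ (suc i) j)) ⟨
      x ↑ n                                     ≈⟨ *-cancelʳ x≉0 (F.trans (F.*-comm (x ↑ n) x) (F.trans x↑1+n≈x (F.sym (F.*-identityˡ x)))) ⟩
      1#                                        ∎))))

    Coset-* : ∀ {x y i} → InSubfield x → ¬ x ≈ 0# → y ∈ Coset i → x ⊛ y ∈ Coset i
    Coset-* {x} {y} {i} x∈ x≉0 (j , _ , y≈) with j′ , _ , x≈ ← InSubfield⇒Coset₀ x∈ x≉0 = α↑∈Coset i (j′ + j) (begin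
      x ⊛ y                                  ≈⟨ F.*-cong x≈ y≈ ⟩
      α ↑ (j′ * β) ⊛ α ↑ (i + j * β)         ≈⟨ ^-homo-* α (j′ * β) (i + j * β) ⟨
      α ↑ (j′ * β + (i + j * β))             ≡⟨ ≡.cong (α ↑_) (≡.trans (≡.sym (ℕ.+-assoc (j′ * β) i (j * β)))
                                                 (≡.trans (≡.cong (_+ j * β) (ℕ.+-comm (j′ * β) i))
                                                 (≡.trans (ℕ.+-assoc i (j′ * β) (j * β))
                                                 (≡.cong (i +_) (≡.sym (ℕ.*-distribʳ-+ β j′ j)))))) ⟩
      α ↑ (i + (j′ + j) * β)                 ∎)

    Coset-quotient : ∀ {x y i} → x ∈ Coset i → y ∈ Coset i → ∃[ z ] InSubfield z × y ≈ z ⊛ x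
    Coset-quotient {x} {y} {i} (j , j<n , x≈) (j′ , _ , y≈) =
      -- This is γ^(j′ - j) with γ = α^β; as γ^n = 1, adding n keeps the exponent natural.
      γ ↑ (j′ + (n ∸ j)) , Coset₀⇒InSubfield (α↑∈Coset 0 (j′ + (n ∸ j))
        (F.trans (F.sym (F.*-identityˡ _)) (F.sym (α↑[i+jβ]≈ 0 (j′ + (n ∸ j)))))) , (begin
      y                                         ≈⟨ F.trans y≈ (α↑[i+jβ]≈ i j′) ⟩
      α ↑ i ⊛ γ ↑ j′                            ≈⟨ F.*-comm _ _ ⟩
      γ ↑ j′ ⊛ α ↑ i                            ≈⟨ F.*-congʳ (F.trans (F.*-congˡ α↑[β*n]≈1) (F.*-identityʳ _)) ⟨
      (γ ↑ j′ ⊛ γ ↑ n) ⊛ α ↑ i                  ≈⟨ F.*-congʳ (^-homo-* γ j′ n) ⟨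
      γ ↑ (j′ + n) ⊛ α ↑ i                      ≡⟨ ≡.cong (λ k → γ ↑ k ⊛ α ↑ i) (≡.trans (ℕ.+-assoc j′ (n ∸ j) j)
                                                    (≡.cong (j′ +_) (ℕ.m∸n+n≡m (ℕ.<⇒≤ j<n)))) ⟨
      γ ↑ (j′ + (n ∸ j) + j) ⊛ α ↑ i            ≈⟨ F.*-congʳ (^-homo-* γ (j′ + (n ∸ j)) j) ⟩
      (γ ↑ (j′ + (n ∸ j)) ⊛ γ ↑ j) ⊛ α ↑ i      ≈⟨ F.*-assoc _ _ _ ⟩
      γ ↑ (j′ + (n ∸ j)) ⊛ (γ ↑ j ⊛ α ↑ i)      ≈⟨ F.*-congˡ (F.trans (F.*-comm _ _) (F.sym (F.trans x≈ (α↑[i+jβ]≈ i j)))) ⟩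
      γ ↑ (j′ + (n ∸ j)) ⊛ x                    ∎)
      where γ = α ↑ β

    subfield-setoid : Setoid ℓ ℓ
    subfield-setoid = ∃-setoid F.setoid InSubfield

    subfield-size : HasSize subfield-setoid (suc n)
    subfield-size = enumeration⇒HasSize (↔-id (Fin (suc n))) f f-injective f-surjective
      where
      f : Fin (suc n) → ∃ InSubfield
      f zero    = 0# , F.zeroˡ _
      f (suc j) = α ↑ (toℕ j * β) , Coset₀⇒InSubfield (α↑∈Coset 0 (toℕ j) F.refl)
      f-injective : ∀ {i j} → proj₁ (f i) ≈ proj₁ (f j) → i ≡ j
      f-injective {zero}  {zero}  _  = refl
      f-injective {zero}  {suc j} eq = contradiction (F.sym eq) (α↑≉0 (toℕ j * β))
      f-injective {suc i} {zero}  eq = contradiction eq (α↑≉0 (toℕ i * β))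
      f-injective {suc i} {suc j} eq = ≡.cong suc (Fin.toℕ-injective (ℕ.*-cancelʳ-≡ (toℕ i) (toℕ j) β
        (α↑-injective (j*β<N 0<β (Fin.toℕ<n i)) (j*β<N 0<β (Fin.toℕ<n j)) eq)))
        where 0<β = >-nonZero⁻¹ β
      f-surjective : ∀ x → ∃[ i ] proj₁ x ≈ proj₁ (f i)
      f-surjective (x , x∈) with x ≟ 0#
      ... | yes x≈0 = zero , x≈0
      ... | no  x≉0 with j , j<n , x≈ ← InSubfield⇒Coset₀ x∈ x≉0 = suc (Fin.fromℕ< j<n) ,
        F.trans x≈ (F.reflexive (≡.cong (λ j → α ↑ (j * β)) (≡.sym (Fin.toℕ-fromℕ< j<n))))

    -- InSubfield is closed under addition only when 1 + n is a power of the characteristic.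
    module Subfield (↑-+ : ∀ x y → (x ⊕ y) ↑ suc n ≈ x ↑ suc n ⊕ y ↑ suc n) where

      +-closed : ∀ {x y} → InSubfield x → InSubfield y → InSubfield (x ⊕ y)
      +-closed x∈ y∈ = F.trans (↑-+ _ _) (F.+-cong x∈ y∈)

      *-closed : ∀ {x y} → InSubfield x → InSubfield y → InSubfield (x ⊛ y)
      *-closed x∈ y∈ = F.trans (^-distrib-* _ _ (suc n)) (F.*-cong x∈ y∈)

      0-closed : InSubfield 0#
      0-closed = F.zeroˡ _

      1-closed : InSubfield 1#
      1-closed = Coset₀⇒InSubfield (α↑∈Coset 0 0 F.refl)

      -- Additivity of the power map makes (-x)^(n+1) an additive inverse of x, which treats even
      -- and odd exponents alike.
      neg-closed : ∀ {x} → InSubfield x → InSubfield (F.- x)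
      neg-closed {x} x∈ = GroupProperties.inverseʳ-unique F.+-group _ _ (begin
        x ⊕ (F.- x) ↑ suc n            ≈⟨ F.+-congʳ x∈ ⟨
        x ↑ suc n ⊕ (F.- x) ↑ suc n    ≈⟨ ↑-+ x (F.- x) ⟨
        (x ⊕ F.- x) ↑ suc n            ≈⟨ ^-congˡ (suc n) (F.-‿inverseʳ x) ⟩
        0# ↑ suc n                     ≈⟨ 0-closed ⟩
        0#                             ∎)

      inverse-closed : ∀ {x y} → y ⊛ x ≈ 1# → InSubfield x → InSubfield y
      inverse-closed {x} {y} yx≈1 x∈ = *-cancelʳ x≉0 (begin
        y ↑ suc n ⊛ x            ≈⟨ F.*-congˡ x∈ ⟨
        y ↑ suc n ⊛ x ↑ suc n    ≈⟨ ^-distrib-* y x (suc n) ⟨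
        (y ⊛ x) ↑ suc n          ≈⟨ ^-congˡ (suc n) yx≈1 ⟩
        1# ↑ suc n               ≈⟨ 1-closed ⟩
        1#                       ≈⟨ yx≈1 ⟨
        y ⊛ x                    ∎)
        where
        x≉0 : ¬ x ≈ 0#
        x≉0 x≈0 = α≉0 (begin
          α                ≈⟨ F.*-identityʳ α ⟨
          α ⊛ 1#           ≈⟨ F.*-congˡ yx≈1 ⟨
          α ⊛ (y ⊛ x)      ≈⟨ F.*-congˡ (F.trans (F.*-congˡ x≈0) (F.zeroʳ y)) ⟩
          α ⊛ 0#           ≈⟨ F.zeroʳ α ⟩
          0#               ∎)

      subfield : CommutativeRing ℓ ℓ
      subfield = record
        { Carrier           = ∃ InSubfield
        ; _≈_               = λ (x , _) (y , _) → x ≈ y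
        ; _+_               = λ (x , x∈) (y , y∈) → x ⊕ y , +-closed x∈ y∈
        ; _*_               = λ (x , x∈) (y , y∈) → x ⊛ y , *-closed x∈ y∈
        ; -_                = λ (x , x∈) → F.- x , neg-closed x∈
        ; 0#                = 0# , 0-closed
        ; 1#                = 1# , 1-closed
        ; isCommutativeRing = record
          { isRing = record
            { +-isAbelianGroup = record
              { isGroup = record
                { isMonoid = record
                  { isSemigroup = record
                    { isMagma = record
                      { isEquivalence = Setoid.isEquivalence subfield-setoid
                      ; ∙-cong        = F.+-cong
                      }
                    ; assoc = λ _ _ _ → F.+-assoc _ _ _
                    }
                  ; identity = (λ _ → F.+-identityˡ _) , (λ _ → F.+-identityʳ _)
                  }
                ; inverse = (λ _ → F.-‿inverseˡ _) , (λ _ → F.-‿inverseʳ _)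
                ; ⁻¹-cong = F.-‿cong
                }
              ; comm = λ _ _ → F.+-comm _ _
              }
            ; *-cong     = F.*-cong
            ; *-assoc    = λ _ _ _ → F.*-assoc _ _ _
            ; *-identity = (λ _ → F.*-identityˡ _) , (λ _ → F.*-identityʳ _)
            ; distrib    = (λ _ _ _ → F.distribˡ _ _ _) , (λ _ _ _ → F.distribʳ _ _ _)
            }
          ; *-comm = λ _ _ → F.*-comm _ _
          }
        }

      private module S = CommutativeRing subfield

      subfield-inverses : HasInverses subfield
      subfield-inverses (x , x∈) x≉0 = let y , yx≈1 = invert x≉0 in (y , inverse-closed yx≈1 x∈) , yx≈1

      overSubfield : LeftModule S.ring ℓ ℓ
      overSubfield = record
        { Carrierᴹ     = Carrier
        ; _≈ᴹ_         = _≈_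
        ; _+ᴹ_         = _⊕_
        ; _*ₗ_         = λ (x , _) y → x ⊛ y
        ; 0ᴹ           = 0#
        ; -ᴹ_          = F.-_
        ; isLeftModule = record
          { isLeftSemimodule = record
            { +ᴹ-isCommutativeMonoid = F.+-isCommutativeMonoid
            ; isPreleftSemimodule    = record
              { *ₗ-cong      = F.*-cong
              ; *ₗ-zeroˡ     = F.zeroˡ
              ; *ₗ-distribʳ  = λ _ _ _ → F.distribʳ _ _ _
              ; *ₗ-identityˡ = F.*-identityˡ
              ; *ₗ-assoc     = λ _ _ _ → F.*-assoc _ _ _
              ; *ₗ-zeroʳ     = λ _ → F.zeroʳ _
              ; *ₗ-distribˡ  = λ _ _ _ → F.distribˡ _ _ _
              }
            }
          ; -ᴹ‿cong    = F.-‿cong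
          ; -ᴹ‿inverse = F.-‿inverse
          }
        }

-- Counting by fibres, and images as subsets of indices.

fibres⇒≤ : ∀ {a b p} (G : Group a b) (let module G = Group G) {N M B} → HasSize G.setoid N →
  ∀ {W : Pred G.Carrier p} → HasSize (∃-setoid G.setoid W) M →
  (ψ : G.Carrier → Fin B) → (∀ {x y} → x G.≈ y → ψ x ≡ ψ y) →
  (∀ x y → ψ x ≡ ψ y → x G.// y ∈ W) → N ≤ M * B
fibres⇒≤ G {N} {M} {B} ∣G∣ {W} ∣W∣ ψ ψ-cong fibre = injection⇒≤ ∣G∣ (≡-size (M * B))
  -- An element is recovered from its fibre together with its offset from the representative of that
  -- fibre.
  (λ x → Fin.combine (Finite.index ∣W∣ (offset x)) (ψ x))
  λ {x} {y} eq →
    let offset≡ , ψ≡ = Fin.combine-injective (Finite.index ∣W∣ (offset x)) (ψ x) (Finite.index ∣W∣ (offset y)) (ψ y) eq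
    in GroupProperties.∙-cancelʳ G _ _ _ (G.trans (Finite.index-injective ∣W∣ offset≡)
         (G.∙-congˡ (G.⁻¹-cong (G.reflexive (≡.cong representative (≡.sym ψ≡))))))
  where
  module G = Group G
  fibre? : ∀ i → Dec (∃[ x ] ψ x ≡ i)
  fibre? i = Finite.any? ∣G∣ (λ x≈y ψx≡i → ≡.trans (ψ-cong (G.sym x≈y)) ψx≡i) (λ x → ψ x Fin.≟ i)
  representative : Fin B → G.Carrier
  representative i with fibre? i
  ... | yes (x , _) = x
  -- A default for empty fibres; `offset` asks only for the fibre of a given x, which is inhabited.
  ... | no  _       = G.ε
  ψ-representative : ∀ x → ψ (representative (ψ x)) ≡ ψ x
  ψ-representative x with fibre? (ψ x)
  ... | yes (_ , eq) = eq
  ... | no  ∄        = contradiction (x , refl) ∄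
  offset : ∀ x → ∃ W
  offset x = x G.// representative (ψ x) , fibre x _ (≡.sym (ψ-representative x))

image : ∀ {m n} → Vector (Fin n) m → Subset n
image {zero}  f = ∅
image {suc m} f = ⁅ f zero ⁆ ∪ image (f ∘ suc)

∈-image : ∀ {m n} (f : Vector (Fin n) m) i → f i ∈ₛ image f
∈-image f zero    = Subset.x∈p∪q⁺ (inj₁ (Subset.x∈⁅x⁆ (f zero)))
∈-image f (suc i) = Subset.x∈p∪q⁺ (inj₂ (∈-image (f ∘ suc) i))

∈-image⁻ : ∀ {m n} (f : Vector (Fin n) m) {x} → x ∈ₛ image f → ∃[ i ] x ≡ f i
∈-image⁻ {zero}  f x∈∅ = contradiction x∈∅ Subset.∉⊥
∈-image⁻ {suc m} f x∈ with Subset.x∈p∪q⁻ ⁅ f zero ⁆ (image (f ∘ suc)) x∈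
... | inj₁ x∈⁅f0⁆ = zero , Subset.x∈⁅y⁆⇒x≡y (f zero) x∈⁅f0⁆
... | inj₂ x∈f′   with i , x≡ ← ∈-image⁻ (f ∘ suc) x∈f′ = suc i , x≡

∣⁅x⁆∪p∣ : ∀ {n} {x : Fin n} {p} → x ∉ₛ p → ∣ ⁅ x ⁆ ∪ p ∣ ≡ suc ∣ p ∣
∣⁅x⁆∪p∣ {x = zero}  {inside  Vec.∷ p} x∉p = contradiction Vec.here x∉p
∣⁅x⁆∪p∣ {x = zero}  {outside Vec.∷ p} x∉p = ≡.cong (suc ∘ ∣_∣) (Subset.∪-identityˡ p)
∣⁅x⁆∪p∣ {x = suc x} {inside  Vec.∷ p} x∉p = ≡.cong suc (∣⁅x⁆∪p∣ (x∉p ∘ Vec.there))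
∣⁅x⁆∪p∣ {x = suc x} {outside Vec.∷ p} x∉p = ∣⁅x⁆∪p∣ (x∉p ∘ Vec.there)

∣image∣ : ∀ {m n} (f : Vector (Fin n) m) → (∀ {i j} → f i ≡ f j → i ≡ j) → ∣ image f ∣ ≡ m
∣image∣ {zero}  {n} f f-inj = Subset.∣⊥∣≡0 n
∣image∣ {suc m} f f-inj = ≡.trans (∣⁅x⁆∪p∣ f0∉) (≡.cong suc (∣image∣ (f ∘ suc) (Fin.suc-injective ∘ f-inj)))
  where
  f0∉ : f zero ∉ₛ image (f ∘ suc)
  f0∉ f0∈ with i , eq ← ∈-image⁻ (f ∘ suc) f0∈ = contradiction (f-inj eq) λ ()

primePower⇒≥2 : ∀ {q} → IsPrimePower q → 2 ≤ q
primePower⇒≥2 (p , e , p-prime , 1≤e , refl) =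
  ℕ.≤-trans (s≤s 1≤e) (n<m^n p e (nonTrivial⇒n>1 p {{prime⇒nonTrivial p-prime}}))

-- The construction inside L.

module Fetching {ℓ} {q m : ℕ} (q-pp : IsPrimePower q) (k r : ℕ) (1+m≡ : suc m ≡ suc k * suc r)
  (E : Extension ℓ q (suc m)) (α : Field.Carrier (Extension.L E)) (α-generates : IsGenerator (Extension.L E) α)
  where

  open Extension E
  open Construction q-pp k (suc r) E α
  open Subspace using (members; isSubspace)
  open 𝕋 using (space)
  open Exp L.commutativeSemiring using (^-assocʳ; ^-congˡ)
  open IsRingMonomorphism mono

  2≤q : 2 ≤ q
  2≤q = primePower⇒≥2 q-pp

  1≤q : 1 ≤ q
  1≤q = ℕ.<⇒≤ 2≤q

  -- With t = r + 1: Q is the order of the subfield, n the number of elements of each `S i`, and N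
  -- the order of the multiplicative group of L.
  Q n N : ℕ
  Q = q ^ suc k
  n = Q ∸ 1
  N = q ^ suc m ∸ 1

  private instance
    n-nonZero : NonZero n
    n-nonZero = q^1+n∸1-nonZero q-pp k
    N-nonZero : NonZero N
    N-nonZero = q^1+n∸1-nonZero q-pp m
    q-nonZero : NonZero q
    q-nonZero = >-nonZero 1≤q
    Q-nonZero : NonZero Q
    Q-nonZero = ℕ.m^n≢0 q (suc k)

  1+n≡Q : suc n ≡ Q
  1+n≡Q = ℕ.suc-pred Q

  q^1+m≡Q^1+r : q ^ suc m ≡ Q ^ suc r
  q^1+m≡Q^1+r = ≡.trans (≡.cong (q ^_) 1+m≡) (≡.sym (ℕ.^-*-assoc q (suc k) (suc r)))

  Q^r≡q^[m∸k] : Q ^ r ≡ q ^ (m ∸ k)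
  Q^r≡q^[m∸k] = ≡.trans (ℕ.^-*-assoc q (suc k) r) (≡.cong (q ^_) (≡.sym
    (≡.trans (≡.cong (_∸ suc k) (≡.trans 1+m≡ (ℕ.*-suc (suc k) r))) (ℕ.m+n∸m≡n (suc k) (suc k * r)))))

  -- Since q^(m+1) = Q^(r+1), `β` is the repunit 1 + Q + ... + Q^r, so the division that defines it
  -- is exact.
  β*n≡N : β * n ≡ N
  β*n≡N = ≡.trans (≡.cong (_* n) (≡.trans (≡.cong (λ x → (x ∸ 1) / n) q^1+m≡Q^1+r) (≡.sym (repunit-/ Q (suc r) (ℕ.m^n>0 q (suc k))))))
    (≡.trans (repunit-*-∸1 Q (suc r) (ℕ.m^n>0 q (suc k))) (≡.cong (_∸ 1) (≡.sym q^1+m≡Q^1+r)))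

  private instance
    β-nonZero : NonZero β
    β-nonZero = ℕ.m*n≢0⇒m≢0 β {{≡.subst NonZero (≡.sym β*n≡N) N-nonZero}}

  ∣L∣′ : HasSize L.setoid (suc N)
  ∣L∣′ = ≡.subst (HasSize L.setoid) (≡.sym (ℕ.suc-pred (q ^ suc m) {{ℕ.m^n≢0 q (suc m)}})) ∣L∣

  open CyclicField L ∣L∣′ α-generates
  open Cosets β n β*n≡N

  -- With q = p^e, both Q and the order of L are powers of p, so L has characteristic p and the Q-th
  -- power is an iterate of the Frobenius map.
  ↑1+n-+ : ∀ x y → (x L.+ y) L.↑ suc n L.≈ x L.↑ suc n L.+ y L.↑ suc n
  ↑1+n-+ =
    let p , e , p-prime , _ , q≡p^e = q-pp
        q^≡ : ∀ d → q ^ d ≡ p ^ (e * d)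
        q^≡ d = ≡.trans (≡.cong (_^ d) q≡p^e) (ℕ.^-*-assoc p e d)
    in ≡.subst (λ Q → ∀ x y → (x L.+ y) L.↑ Q L.≈ x L.↑ Q L.+ y L.↑ Q) (≡.sym (≡.trans 1+n≡Q (q^≡ (suc k))))
      (Frobenius.↑p^n-+ L.commutativeRing p-prime
        (FiniteField.characteristic L ∣L∣ {e = e * suc m} (q^≡ (suc m))) (e * suc k))

  module Subfieldᶠ = Subfield ↑1+n-+
  open Subfieldᶠ using (subfield; subfield-inverses; overSubfield)

  -- In K, c^q = c; applying this k + 1 times gives c^Q = c. Hence F-subspaces are also subspaces
  -- over K.
  ι∈subfield : ∀ c → InSubfield (ι c)
  ι∈subfield c = ≡.subst (λ Q → ι c L.↑ Q L.≈ ι c) (≡.sym 1+n≡Q) (ι↑q^ (suc k))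
    where
    ι-↑ : ∀ n → ι (c K.↑ n) L.≈ ι c L.↑ n
    ι-↑ zero    = 1#-homo
    ι-↑ (suc n) = L.trans (*-homo c (c K.↑ n)) (L.*-congˡ (ι-↑ n))
    ι↑q^ : ∀ d → ι c L.↑ (q ^ d) L.≈ ι c
    ι↑q^ zero    = L.*-identityʳ (ι c)
    ι↑q^ (suc d) = L.trans (L.sym (^-assocʳ (ι c) q (q ^ d))) (L.trans
      (^-congˡ (q ^ d) (L.trans (L.sym (ι-↑ q)) (⟦⟧-cong (FiniteField.↑N≈ K ∣K∣ c)))) (ι↑q^ d))

  module 𝕍 = LeftModule 𝕍
  module OverK = FiniteVectorSpace K.commutativeRing (FiniteField.inverses K ∣K∣) 2≤q ∣K∣ 𝕍 ∣L∣
  module OverF = FiniteVectorSpace subfield subfield-inverses (s≤s (>-nonZero⁻¹ n)) subfield-size overSubfield ∣L∣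
  module F = CommutativeRing subfield
  module Comb = LinearCombinations K.commutativeRing 𝕍
  module Combᶠ = LinearCombinations subfield overSubfield
  module Forms = LinearForms K.commutativeRing 𝕍
  open OverK using (module Line)
  open Finite ∣L∣ using (_≟_; all?)

  InSubfield? : Decidable InSubfield
  InSubfield? x = (x L.↑ suc n) ≟ x

  InSubfield-resp : ∀ {x y} → x L.≈ y → InSubfield x → InSubfield y
  InSubfield-resp x≈y x∈ = L.trans (^-congˡ (suc n) (L.sym x≈y)) (L.trans x∈ x≈y)

  overF⇒overK : ∀ {W} → IsSubspace overSubfield W → IsSubspace 𝕍 W
  overF⇒overK W = record
    { resp      = resp
    ; 0-closed  = 0-closed
    ; +-closed  = +-closed
    ; *ₗ-closed = λ c → *ₗ-closed (ι c , ι∈subfield c)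
    }
    where open IsSubspace W

  -- This reduces a claim about all multipliers in a span to the vectors that span it.
  multiplier-isSubspace : ∀ {W} → IsSubspace 𝕍 W → ∀ x → IsSubspace 𝕍 (λ y → y L.* x ∈ W)
  multiplier-isSubspace W x = record
    { resp      = λ y≈z → resp (L.*-congʳ y≈z)
    ; 0-closed  = resp (L.sym (L.zeroˡ x)) 0-closed
    ; +-closed  = λ yx∈W zx∈W → resp (L.sym (L.distribʳ x _ _)) (+-closed yx∈W zx∈W)
    ; *ₗ-closed = λ c yx∈W → resp (L.sym (L.*-assoc _ _ x)) (*ₗ-closed c yx∈W)
    }
    where open IsSubspace W

  subfield-isSubspace : IsSubspace 𝕍 InSubfield
  subfield-isSubspace = record
    { resp      = InSubfield-resp
    ; 0-closed  = Subfieldᶠ.0-closed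
    ; +-closed  = Subfieldᶠ.+-closed
    ; *ₗ-closed = λ c → Subfieldᶠ.*-closed (ι∈subfield c)
    }

  subfield-basis : Σ[ y ∈ Vector L.Carrier (suc k) ] IsBasis 𝕍 InSubfield y
  subfield-basis = OverK.size⇒basis subfield-isSubspace InSubfield?
    (≡.subst (HasSize subfield-setoid) 1+n≡Q subfield-size)

  -- Cosets, points and the hyperplane side.

  ≉0⇒∈S : ∀ {x} → ¬ x L.≈ L.0# → ∃[ i ] x ∈ S i
  ≉0⇒∈S {x} x≉0 with i , i<β , x∈ ← coset x≉0 =
    Fin.fromℕ< i<β , ≡.subst (λ i → x ∈ Coset i) (≡.sym (Fin.toℕ-fromℕ< i<β)) x∈

  S-disjoint : ∀ {x i j} → x ∈ S i → x ∈ S j → i ≡ j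
  S-disjoint {i = i} {j} x∈Sᵢ x∈Sⱼ = Fin.toℕ-injective (cosets-disjoint (Fin.toℕ<n i) (Fin.toℕ<n j) x∈Sᵢ x∈Sⱼ)

  S-resp : ∀ {i x y} → x L.≈ y → x ∈ S i → y ∈ S i
  S-resp x≈y (j , j<n , x≈) = j , j<n , L.trans (L.sym x≈y) x≈

  -- It turns combinations over F of coset members into combinations over K. As 0 lies in no coset,
  -- a zero product is written as coefficient 0 times the given y.
  rescale : ∀ {x y} i → InSubfield x → y ∈ S i → ∃[ c ] ∃[ z ] z ∈ S i × x L.* y L.≈ ι c L.* z
  rescale {x} {y} i x∈F y∈S with x ≟ L.0#
  ... | yes x≈0 = K.0# , y , y∈S , L.*-congʳ (L.trans x≈0 (L.sym 0#-homo))
  ... | no  x≉0 = K.1# , x L.* y , Coset-* {i = toℕ i} x∈F x≉0 y∈S ,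
    L.sym (L.trans (L.*-congʳ 1#-homo) (L.*-identityˡ _))

  generator∈S : ∀ A i → members A ⊆ S∪0 i → Line.generator A ∈ S i
  generator∈S A i A⊆ with A⊆ (Line.generator∈ A)
  ... | inj₁ a∈S = a∈S
  ... | inj₂ a≈0 = contradiction a≈0 (Line.generator≉0 A)

  point⊆S∪0 : ∀ A → ∃[ i ] members A ⊆ S∪0 i
  point⊆S∪0 A = i , A⊆S∪0
    where
    i = proj₁ (≉0⇒∈S (Line.generator≉0 A))
    A⊆S∪0 : members A ⊆ S∪0 i
    A⊆S∪0 {x} x∈A with x ≟ L.0#
    ... | yes x≈0 = inj₂ x≈0
    ... | no  x≉0 = let s , x≈sa = Line.∈⇒multiple A x∈A in
      inj₁ (S-resp {i} (L.sym x≈sa) (Coset-* {i = toℕ i} (ι∈subfield s)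
        (λ s≈0 → x≉0 (L.trans x≈sa (L.trans (L.*-congʳ s≈0) (L.zeroˡ _))))
        (proj₂ (≉0⇒∈S (Line.generator≉0 A)))))

  -- Injectivity: a generator of the point is nonzero and would lie in both cosets, which are
  -- disjoint. Surjectivity: K-multiples of the generator stay in its coset, since K embeds in F.
  itemByHyperplane-bijective : ∀ H →
    Bijective (Setoid._≈_ (FetchesByHyperplane H)) (Setoid._≈_ (EdgesAtHyperplane H)) (itemByHyperplane H)
  itemByHyperplane-bijective H =
      (λ { {i , (A , _) , A⊆} {i′ , (A′ , _) , A′⊆} A≋A′@(_ , A′⊆A) →
        S-disjoint (generator∈S A i A⊆) (generator∈S A i′ (λ x∈A → A′⊆ (proj₁ A≋A′ x∈A))) , A≋A′ })
    , (λ (A , A⊆H) → let i , A⊆ = point⊆S∪0 A in (i , (A , A⊆H) , A⊆) , λ z≈ → proj₂ z≈)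

  -- The largest subspace over GF(q^(k+1)) inside H.
  module Core (H : Hyperplane) where

    Core : Pred L.Carrier ℓ
    Core x = ∀ y → InSubfield y → y L.* x ∈ members H

    open IsSubspace (isSubspace H)

    core-isSubspace : IsSubspace overSubfield Core
    core-isSubspace = record
      { resp      = λ x≈x′ x∈ y y∈F → resp (L.*-congˡ x≈x′) (x∈ y y∈F)
      ; 0-closed  = λ y _ → resp (L.sym (L.zeroʳ y)) 0-closed
      ; +-closed  = λ x∈ x′∈ y y∈F → resp (L.sym (L.distribˡ y _ _)) (+-closed (x∈ y y∈F) (x′∈ y y∈F))
      ; *ₗ-closed = λ (c , c∈F) x∈ y y∈F → resp (L.*-assoc y c _) (x∈ (y L.* c) (Subfieldᶠ.*-closed y∈F c∈F))
      }

    core-isSubspaceᴷ : IsSubspace 𝕍 Core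
    core-isSubspaceᴷ = overF⇒overK core-isSubspace

    core? : Decidable Core
    core? x = all? (λ y≈z y*x∈H z∈F → resp (L.*-congʳ y≈z) (y*x∈H (InSubfield-resp (L.sym y≈z) z∈F)))
      (λ y → InSubfield? y →-dec OverK.member? H (y L.* x))

    core⊆H : Core ⊆ members H
    core⊆H x∈ = resp (L.*-identityˡ _) (x∈ L.1# Subfieldᶠ.1-closed)

    InCore : Setoid ℓ ℓ
    InCore = ∃-setoid L.setoid Core

    -- With f a linear form of kernel H and y₁ … y₁₊ₖ a basis of the subfield, the core is the
    -- common kernel of the k + 1 forms x ↦ f (yᵢ x).
    codimension≤1+k : ∀ {M} → HasSize InCore M → ∀ f → members H ≐ Forms.Kernel f →
      ∀ {y : Vector L.Carrier (suc k)} → IsBasis 𝕍 InSubfield y → q ^ suc m ≤ M * Q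
    codimension≤1+k ∣Core∣ f (_ , ker⊆H) {y} y-basis = fibres⇒≤ L.+-group ∣L∣ ∣Core∣ ψ
      (λ x≈y → V.to-cong λ l → f.·-cong (L.*-congˡ {y l} x≈y)) fibre
      where
      module f = Forms.LinearForm f
      module V = Finite (vectors-size ∣K∣ (suc k))
      forms : L.Carrier → Vector K.Carrier (suc k)
      forms x l = f._·_ (y l L.* x)
      ψ : L.Carrier → Fin Q
      ψ x = V.index (forms x)
      -- Equal values of the forms put yₗ(x - x′) in H for every l; the multipliers of x - x′ into H
      -- form a K-subspace, which therefore contains all of F.
      fibre : ∀ x x′ → ψ x ≡ ψ x′ → Core (x L.- x′)
      fibre x x′ ψx≡ψx′ z z∈F = let c , z≈cy = IsBasis.spanning y-basis z∈F in
        IsSubspace.resp (multiplier-isSubspace (isSubspace H) (x L.- x′)) (L.sym z≈cy)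
          (Comb.lincomb-closed (multiplier-isSubspace (isSubspace H) (x L.- x′)) c λ l →
            resp (L.sym (RingProperties.x[y-z]≈xy-xz L.ring (y l) x x′))
              (ker⊆H (K.trans (Forms.·-- f (y l L.* x) (y l L.* x′))
                (GroupProperties.x≈y⇒x∙y⁻¹≈ε K.+-group (V.index-injective {forms x} {forms x′} ψx≡ψx′ l)))))

    core-size : HasSize InCore (suc n ^ r)
    core-size = ≡.subst (λ d → HasSize InCore (suc n ^ d)) (ℕ.≤-antisym d≤r r≤d) ∣Core∣
      where
      core-basis = OverF.subspace-basis core-isSubspace core?
      d = proj₁ core-basis
      ∣Core∣ : HasSize InCore (suc n ^ d)
      ∣Core∣ = OverF.basis⇒size core-isSubspace (proj₂ (proj₂ core-basis))
      H≐Kernel = OverK.Hyperplanes.hyperplane⇒kernel refl H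
      q^1+m≡ : q ^ suc m ≡ suc n ^ suc r
      q^1+m≡ = ≡.trans q^1+m≡Q^1+r (≡.cong (_^ suc r) (≡.sym 1+n≡Q))
      2≤1+n = s≤s (>-nonZero⁻¹ n)
      -- With d at least r + 1 the core would have at least Q^(r+1) = q^(m+1) elements, more than
      -- the q^m of H.
      d≤r : d ≤ r
      d≤r = ℕ.≮⇒≥ λ r<d → ℕ.<⇒≱ (ℕ.^-monoʳ-< q 2≤q (ℕ.n<1+n m)) (ℕ.≤-trans (ℕ.≤-reflexive q^1+m≡)
        (ℕ.≤-trans (ℕ.^-monoʳ-≤ (suc n) r<d)
          (injection⇒≤ ∣Core∣ (OverK.basis⇒size (isSubspace H) (Subspace.isBasis H)) (λ (x , x∈) → x , core⊆H x∈) id)))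
      -- The codimension bound reads Q^(r+1) ≤ Q^d · Q.
      r≤d : r ≤ d
      r≤d = s≤s⁻¹ (^-cancelʳ-≤ (suc n) 2≤1+n (ℕ.≤-trans (ℕ.≤-reflexive (≡.sym q^1+m≡))
        (ℕ.≤-trans (codimension≤1+k ∣Core∣ (proj₁ H≐Kernel) (proj₂ (proj₂ (proj₂ H≐Kernel))) (proj₂ subfield-basis))
          (ℕ.≤-reflexive (≡.trans (≡.cong (suc n ^ d *_) (≡.sym 1+n≡Q)) (ℕ.*-comm (suc n ^ d) (suc n)))))))

    core-sizeᴷ : HasSize InCore (q ^ (m ∸ k))
    core-sizeᴷ = ≡.subst (HasSize InCore) (≡.trans (≡.cong (_^ r) 1+n≡Q) Q^r≡q^[m∸k]) core-size

    -- Each vector of an F-basis of the core selects the coset that contains it; over K these r = t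
    -- - 1 cosets span the core.
    module CosetBasis {u : Vector L.Carrier r} (u-basis : IsBasis overSubfield Core u) where

      private module u = IsBasis u-basis

      u≉0 : ∀ l → ¬ u l L.≈ L.0#
      u≉0 l ul≈0 = OverF.1≉0 (L.trans (L.sym (Combᶠ.unit-diagonal l))
        (u.independent (Combᶠ.unit l) (L.trans (Combᶠ.lincomb-unit l u) ul≈0) l))

      index : Fin r → Fin β
      index l = proj₁ (≉0⇒∈S (u≉0 l))
      u∈S : ∀ l → u l ∈ S (index l)
      u∈S l = proj₂ (≉0⇒∈S (u≉0 l))

      -- Two basis vectors in the same coset would differ by a factor in F, against independence
      -- over F.
      index-injective : ∀ {l l′} → index l ≡ index l′ → l ≡ l′
      index-injective {l} {l′} eq = decidable-stable (l Fin.≟ l′) λ l≢l′ →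
        let z , z∈F , ul′≈zul = Coset-quotient {i = toℕ (index l)} (u∈S l) (≡.subst (λ i → u l′ ∈ S i) (≡.sym eq) (u∈S l′))
            zᶠ = z , z∈F
        in OverF.1≉0 (L.trans (L.sym (Combᶠ.unit-diagonal l′)) (L.trans
          (Combᶠ.independent⇒injective {v = u} {c = Combᶠ.unit l′} {d = λ i → zᶠ F.* Combᶠ.unit l i} u.independent
            (L.trans (Combᶠ.lincomb-unit l′ u) (L.trans ul′≈zul (L.sym (L.trans (Combᶠ.lincomb-* zᶠ (Combᶠ.unit l) u)
              (L.*-congˡ (Combᶠ.lincomb-unit l u)))))) l′)
          (L.trans (L.*-congˡ (Combᶠ.unit-offDiagonal l≢l′)) (L.zeroʳ z))))

      core⊆Span : Core ⊆ Span 𝕍 (⋃S (image index))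
      core⊆Span {x} x∈ = let c , x≈cu = u.spanning x∈ in
        r , (λ l → proj₁ (cu l (c l))) , (λ l → proj₁ (proj₂ (cu l (c l)))) ,
        (λ l → index l , ∈-image index l , proj₁ (proj₂ (proj₂ (cu l (c l))))) ,
        L.trans x≈cu (Sum.sum-cong-≋ L.+-commutativeMonoid {r} λ l → proj₂ (proj₂ (proj₂ (cu l (c l)))))
        where
        cu : ∀ l c → ∃[ d ] ∃[ v ] v ∈ S (index l) × proj₁ c L.* u l L.≈ ι d L.* v
        cu l (c , c∈F) = rescale (index l) c∈F (u∈S l)

      S⊆core : ∀ {x} l → x ∈ S (index l) → x ∈ Core
      S⊆core l x∈S = let z , z∈F , x≈zul = Coset-quotient {i = toℕ (index l)} (u∈S l) x∈S in
        IsSubspace.resp core-isSubspace (L.sym x≈zul) (IsSubspace.*ₗ-closed core-isSubspace (z , z∈F) (u.members l))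

      Span⊆core : Span 𝕍 (⋃S (image index)) ⊆ Core
      Span⊆core (d , c , v , v∈S , x≈cv) = IsSubspace.resp core-isSubspace (L.sym x≈cv)
        (Comb.lincomb-closed core-isSubspaceᴷ c λ j → let i , i∈ , vj∈ = v∈S j ; l , i≡ = ∈-image⁻ index i∈ in
          S⊆core l (≡.subst (λ i → v j ∈ S i) i≡ vj∈))

    core : 𝕋
    core = record
      { space   = OverK.size⇒Subspace core-isSubspaceᴷ core? core-sizeᴷ
      ; indices = image index
      ; size    = ∣image∣ index index-injective
      ; spanned = core⊆Span , Span⊆core
      }
      where open CosetBasis (proj₂ (OverF.size⇒basis core-isSubspace core? core-size))

    -- Once T lies in the core, equality is a count: a core vector outside T would extend the basis
    -- of T to m - k + 1 independent vectors in a space of size q^(m-k).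
    𝕋⊆H⇒≐core : ∀ (T : 𝕋) → space T ⊑ H → members (space T) ≐ Core
    𝕋⊆H⇒≐core T T⊆H = T⊆Core , λ {x} x∈Core → decidable-stable (OverK.member? (space T) x) λ x∉T →
      ℕ.<⇒≱ (ℕ.^-monoʳ-< q 2≤q (ℕ.n<1+n (m ∸ k)))
        (OverK.independent⇒q^n≤size {v = x ∷ T.basis} core-isSubspaceᴷ core-sizeᴷ
          (OverK.independent-∷ {v = T.basis} b.independent
            λ (c , x≈cb) → x∉T (IsSubspace.resp T.isSubspace (L.sym x≈cb) (Comb.lincomb-closed T.isSubspace c b.members)))
          λ { zero → x∈Core ; (suc l) → T⊆Core (b.members l) })
      where
      module T = Subspace (space T)
      module b = IsBasis T.isBasis
      ⋃S⊆T : ⋃S (𝕋.indices T) ⊆ T.members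
      ⋃S⊆T {x} x∈ = proj₂ (𝕋.spanned T) (1 , (λ _ → K.1#) , (λ _ → x) , (λ _ → x∈) ,
        L.sym (L.trans (L.+-identityʳ _) (𝕍.*ₗ-identityˡ x)))
      T⊆Core : T.members ⊆ Core
      T⊆Core {x} x∈T y y∈F with y ≟ L.0#
      ... | yes y≈0 = resp (L.sym (L.trans (L.*-congʳ y≈0) (L.zeroˡ x))) 0-closed
      -- To see that y x stays in T, the vectors x with x y in T are viewed as a subspace over K; it
      -- contains every `v j`, as y times a member of a coset stays in that coset, and hence their
      -- combination x.
      ... | no  y≉0 = let d , c , v , v∈S , x≈cv = proj₁ (𝕋.spanned T) x∈T in T⊆H (IsSubspace.resp T.isSubspace (L.*-comm x y)
        (IsSubspace.resp (multiplier-isSubspace T.isSubspace y) (L.sym x≈cv)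
          (Comb.lincomb-closed (multiplier-isSubspace T.isSubspace y) c λ j → let i , i∈ , vj∈ = v∈S j in
            IsSubspace.resp T.isSubspace (L.*-comm y (v j)) (⋃S⊆T (i , i∈ , Coset-* {i = toℕ i} y∈F y≉0 vj∈)))))

  -- A hyperplane determines the T it was fetched from, namely its core, and every hyperplane has a
  -- core in `𝕋`.
  itemByPoint-bijective : ∀ A →
    Bijective (Setoid._≈_ (FetchesByPoint A)) (Setoid._≈_ (EdgesAtPoint A)) (itemByPoint A)
  itemByPoint-bijective A =
      (λ { {T , (H , _) , T⊆H} {T′ , (H′ , _) , T′⊆H′} H≋H′@(_ , H′⊆H) →
        -- T′ is compared with the core of H rather than that of H′, which is possible because H′ is
        -- contained in H.
        ≐-trans (Core.𝕋⊆H⇒≐core H T T⊆H) (≐-sym (Core.𝕋⊆H⇒≐core H T′ (λ x∈T′ → H′⊆H (T′⊆H′ x∈T′)))) , H≋H′ })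
    , (λ (H , A⊆H) → (Core.core H , (H , A⊆H) , Core.core⊆H H) , λ z≈ → proj₂ z≈)

  -- Degrees and the two statements.

  degree : ℕ
  degree = ((q ^ m ∸ 1) / (q ∸ 1)) {{q∸1-nonZero q-pp}}

  repunit≡degree : repunit q m ≡ degree
  repunit≡degree = repunit-/ q m 1≤q {{q∸1-nonZero q-pp}}

  -- `hyperplanesThrough` and `pointsIn` unfold to the same setoids as the edges at a vertex, so the
  -- projective counts apply directly.
  EdgesAtPoint-size : ∀ A → HasSize (EdgesAtPoint A) degree
  EdgesAtPoint-size A = ≡.subst (HasSize (EdgesAtPoint A)) repunit≡degree (OverK.Hyperplanes.hyperplanesThrough-size refl A)

  EdgesAtHyperplane-size : ∀ H → HasSize (EdgesAtHyperplane H) degree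
  EdgesAtHyperplane-size H = ≡.subst (HasSize (EdgesAtHyperplane H)) repunit≡degree (OverK.pointsIn-size H)

-- That every item is obtained exactly once is expressed by the bijectivity of forgetting its
-- source; the number of fetches is then carried over from the number of edges.
lemma23 : ∀ {ℓ} (q m k t : ℕ) (q-pp : IsPrimePower q) →
    1 ≤ k → 3 ≤ t → suc m ≡ suc k * t →
    (E : Extension ℓ q (suc m)) (α : Field.Carrier (Extension.L E)) →
    IsGenerator (Extension.L E) α →
    let open Construction q-pp k t E α
        degree = ((q ^ m ∸ 1) / (q ∸ 1)) {{q∸1-nonZero q-pp}} in
    (∀ (A : Point) →
      Bijective (Setoid._≈_ (FetchesByPoint A)) (Setoid._≈_ (EdgesAtPoint A)) (itemByPoint A) ×
      HasSize (FetchesByPoint A) degree ×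
      HasSize (EdgesAtPoint A) degree) ×
    (∀ (H : Hyperplane) →
      Bijective (Setoid._≈_ (FetchesByHyperplane H)) (Setoid._≈_ (EdgesAtHyperplane H)) (itemByHyperplane H) ×
      HasSize (FetchesByHyperplane H) degree ×
      HasSize (EdgesAtHyperplane H) degree)
lemma23 q m k (suc r) q-pp _ (s≤s _) 1+m≡ E α α-generates =
    (λ A → itemByPoint-bijective A
         , bijective⇒HasSize (itemByPoint A) (itemByPoint-bijective A) (EdgesAtPoint-size A)
         , EdgesAtPoint-size A)
  , (λ H → itemByHyperplane-bijective H
         , bijective⇒HasSize (itemByHyperplane H) (itemByHyperplane-bijective H) (EdgesAtHyperplane-size H)
         , EdgesAtHyperplane-size H)
  where
  open Construction q-pp k (suc r) E α
  open Fetching q-pp k r 1+m≡ E α α-generates
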